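{- For $n\in\omega$ let $\mathcal V_n=\mathsf{HSP}(\mathbf J_n)$ be the variety generated by $\mathbf J_n$. (1) Up to isomorphism, the only subdirectly irreducible algebra in $\mathcal V_0$ is $\mathbf J_0$ itself. (2) Let $n\in\omega\setminus\{0\}$. Up to isomorphism, $\mathcal V_n$ contains $n+1$ subdirectly irreducible algebras: the four-element algebra $\mathbf J_{0,n}$ and the six-element algebras $\mathbf J_{1,n,k}$, for $k\in\{1,\dots,n\}$. Moreover, for all $n\in\omega$: (3) The algebras $\mathbf J_{0,n}$ and $\mathbf J_{1,n,k}$, for $k\in\{1,\dots,n\}$, are injective in $\mathcal V_n$. (4) Every algebra in $\mathcal V_n$ embeds into an injective algebra in $\mathcal V_n$. (5) $\mathcal V_n$ has the congruence extension property and the amalgamation property.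
   Context: **The algebra $\mathbf J_n$.** $J_n=\{\top,\bot,f_0,\dots,f_n,t_0,\dots,t_n\}$ ($2n+4$ distinct elements). Knowledge order $\leqslant_k$: $\bot$ is least, $\top$ is greatest, $f_n<_k\cdots<_k f_0$, $t_n<_k\cdots<_k t_0$, each $f_i$ incomparable to each $t_j$. Truth order $\leqslant_t$: $f_0<_t\cdots<_t f_n<_t x<_t t_n<_t\cdots<_t t_0$ for both $x\in\{\top,\bot\}$, with $\top,\bot$ incomparable. $\otimes,\oplus$ are meet and join for $\leqslant_k$, $\wedge,\vee$ are meet and join for $\leqslant_t$; $\neg\top=\top$, $\neg\bot=\bot$, $\neg f_m=t_m$, $\neg t_m=f_m$. $\mathbf J_n=\langle J_n;\otimes,\oplus,\wedge,\vee,\neg,\top,f_0,\dots,f_n,t_0,\dots,t_n,\bot\rangle$, every element being named by a constant. **$\mathbf J_{0,n}$** is the algebra in the signature of $\mathbf J_n$ whose universe, operations $\otimes,\oplus,\wedge,\vee,\neg$ and constants $\top,\bot$ are those of $\mathbf J_0$, with all constants $f_0,\dots,f_n$ taking the value $f_0$ and all constants $t_0,\dots,t_n$ taking the value $t_0$ (so $\mathbf J_{0,0}=\mathbf J_0$). **$\mathbf J_{1,n,k}$** ($n\geqslant1$, $1\leqslant k\leqslant n$) is the algebra in the signature of $\mathbf J_n$ with universe $\{\top,\mathbf 0,f,\mathbf 1,t,\bot\}$ whose operations $\otimes,\oplus,\wedge,\vee,\neg$ and constants $\top,\bot$ are those of $\mathbf J_1$ with $f_0,f_1,t_0,t_1$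 renamed $\mathbf 0,f,\mathbf 1,t$ respectively; the constants $f_0,\dots,f_{k-1}$ take the value $\mathbf 0$, $f_k,\dots,f_n$ the value $f$, $t_0,\dots,t_{k-1}$ the value $\mathbf 1$, and $t_k,\dots,t_n$ the value $t$. An algebra $\mathbf C\in\mathcal V_n$ is injective in $\mathcal V_n$ if for every embedding $\mathbf A\to\mathbf B$ in $\mathcal V_n$, each homomorphism $\mathbf A\to\mathbf C$ extends to a homomorphism $\mathbf B\to\mathbf C$. -}

module Defs where

import Algebra.Construct.NaturalChoice.Max as Max
import Algebra.Construct.NaturalChoice.Min as Min
open import Data.Bool.Base using (if_then_else_)
open import Data.Fin.Base using (Fin; zero; suc; toℕ; fromℕ; _≤_)
open import Data.Fin.Patterns using (0F; 1F)
import Data.Fin.Properties as Fin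
open import Data.Nat.Base using (ℕ; suc; _<ᵇ_)
open import Data.Product.Base using (∃; ∃₂; Σ; Σ-syntax; _×_; _,_; proj₁; proj₂)
open import Data.Sum.Base using (_⊎_)
open import Function.Base using (_∘_; id; const)
open import Function.Bundles using (Func)
open import Function.Definitions using (Injective; Surjective; Bijective)
open import Level using (Level; _⊔_) renaming (suc to lsuc)
open import Relation.Binary.Bundles using (Poset; Setoid)
open import Relation.Binary.Core using (Rel)
open import Relation.Binary.Lattice.Structures using (IsLattice)
open import Relation.Binary.PropositionalEquality using (_≡_; refl; cong; cong₂)
open import Relation.Binary.PropositionalEquality.Properties using (setoid) renaming (isEquivalence to ≡-isEquivalence)
open import Relation.Binary.Structures using (IsEquivalence)
open import Relation.Nullary.Negation using (¬_)
open import Relation.Unary using (Pred)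

private
  variable
    ℓ ℓ′ : Level

------------------------------------------------------------------------
-- Zorn's lemma.  Agda has no choice principle for setoids, so the axiom
-- of choice is used in this form, as an explicit hypothesis.

ZornsLemma : (a ℓ₁ ℓ₂ c : Level) → Set (lsuc (a ⊔ ℓ₁ ⊔ ℓ₂ ⊔ c))
ZornsLemma a ℓ₁ ℓ₂ c =
  (𝐏 : Poset a ℓ₁ ℓ₂) → let open Poset 𝐏 renaming (_≤_ to _⊑_) in
  ((C : Pred Carrier c) →
    (∀ x y → C x → C y → (x ⊑ y) ⊎ (y ⊑ x)) →
    ∃ λ u → ∀ x → C x → x ⊑ u) →
  ∃ λ m → ∀ x → m ⊑ x → x ≈ m

------------------------------------------------------------------------
-- Universal algebra.  Algebras are setoid based: A ._≈_ is the equality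
-- of A, and quotients are formed by coarsening it.

record Signature : Set₁ where
  field
    Op    : Set
    arity : Op → ℕ

open Signature public

record Algebra (𝓢 : Signature) (ℓ : Level) : Set (lsuc ℓ) where
  field
    domain : Setoid ℓ ℓ
  open Setoid domain public using (Carrier; _≈_)
  field
    op      : (o : Op 𝓢) → (Fin (arity 𝓢 o) → Carrier) → Carrier
    op-cong : ∀ o {xs ys} → (∀ i → xs i ≈ ys i) → op o xs ≈ op o ys

open Algebra using (domain; Carrier; op)

private
  variable
    𝓢 : Signature

record Hom (A B : Algebra 𝓢 ℓ) : Set ℓ where
  open Algebra B using (_≈_)
  field
    func      : Func (domain A) (domain B)
  open Func func public using (to; cong)
  field
    preserves : ∀ o xs → to (op A o xs) ≈ op B o (to ∘ xs)

open Hom using (to)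

IsEmbedding : {A B : Algebra 𝓢 ℓ} → Hom A B → Set ℓ
IsEmbedding {A = A} {B} h = Injective (Algebra._≈_ A) (Algebra._≈_ B) (to h)

IsSurjective : {A B : Algebra 𝓢 ℓ} → Hom A B → Set ℓ
IsSurjective {A = A} {B} h = Surjective (Algebra._≈_ A) (Algebra._≈_ B) (to h)

infix 4 _≅_ _↪_

_≅_ : Algebra 𝓢 ℓ → Algebra 𝓢 ℓ → Set ℓ
A ≅ B = Σ[ h ∈ Hom A B ] IsEmbedding h × IsSurjective h

_↪_ : Algebra 𝓢 ℓ → Algebra 𝓢 ℓ → Set ℓ
A ↪ B = Σ[ h ∈ Hom A B ] IsEmbedding h

Π : (I : Set ℓ) → (I → Algebra 𝓢 ℓ) → Algebra 𝓢 ℓ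
Π I 𝒜 = record
  { domain  = record
    { Carrier       = ∀ i → Carrier (𝒜 i)
    ; _≈_           = λ x y → ∀ i → Algebra._≈_ (𝒜 i) (x i) (y i)
    ; isEquivalence = record
      { refl  = λ i → Setoid.refl (domain (𝒜 i))
      ; sym   = λ p i → Setoid.sym (domain (𝒜 i)) (p i)
      ; trans = λ p q i → Setoid.trans (domain (𝒜 i)) (p i) (q i)
      }
    }
  ; op      = λ o xs i → op (𝒜 i) o (λ j → xs j i)
  ; op-cong = λ o p i → Algebra.op-cong (𝒜 i) o (λ j → p j i)
  }

record Subuniverse (A : Algebra 𝓢 ℓ) : Set (lsuc ℓ) where
  open Algebra A using (_≈_)
  field
    _∈U    : Pred (Carrier A) ℓ
    resp   : ∀ {x y} → x ≈ y → x ∈U → y ∈U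
    closed : ∀ o xs → (∀ i → xs i ∈U) → op A o xs ∈U

subalgebra : (A : Algebra 𝓢 ℓ) → Subuniverse A → Algebra 𝓢 ℓ
subalgebra A U = record
  { domain  = record
    { Carrier       = Σ (Carrier A) _∈U
    ; _≈_           = λ x y → proj₁ x ≈ proj₁ y
    ; isEquivalence = record
      { refl  = Setoid.refl (domain A)
      ; sym   = Setoid.sym (domain A)
      ; trans = Setoid.trans (domain A)
      }
    }
  ; op      = λ o xs → op A o (proj₁ ∘ xs) , closed o (proj₁ ∘ xs) (proj₂ ∘ xs)
  ; op-cong = λ o p → Algebra.op-cong A o p
  }
  where
  open Subuniverse U
  open Algebra A using (_≈_)

Class : Signature → (ℓ : Level) → Set (lsuc (lsuc ℓ))
Class 𝓢 ℓ = Pred (Algebra 𝓢 ℓ) (lsuc ℓ)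

H S P : Class 𝓢 ℓ → Class 𝓢 ℓ
H 𝒦 B = ∃ λ A → 𝒦 A × (Σ[ h ∈ Hom A B ] IsSurjective h)
S 𝒦 B = ∃ λ A → 𝒦 A × (Σ[ U ∈ Subuniverse A ] B ≅ subalgebra A U)
P {ℓ = ℓ} 𝒦 B =
  Σ[ I ∈ Set ℓ ] Σ[ 𝒜 ∈ (I → Algebra _ ℓ) ] (∀ i → 𝒦 (𝒜 i)) × (B ≅ Π I 𝒜)

⟦_⟧ : Algebra 𝓢 ℓ → Class 𝓢 ℓ
⟦ A ⟧ B = B ≡ A

HSP : Algebra 𝓢 ℓ → Class 𝓢 ℓ
HSP A = H (S (P ⟦ A ⟧))

record Congruence (A : Algebra 𝓢 ℓ) : Set (lsuc ℓ) where
  open Algebra A using (_≈_)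
  field
    _θ_           : Rel (Carrier A) ℓ
    contains-≈    : ∀ {x y} → x ≈ y → x θ y
    isEquivalence : IsEquivalence _θ_
    compatible    : ∀ o {xs ys} → (∀ i → xs i θ ys i) → op A o xs θ op A o ys

-- The one-element algebra is not counted as subdirectly irreducible.
SubdirectlyIrreducible : Algebra 𝓢 ℓ → Set (lsuc ℓ)
SubdirectlyIrreducible {𝓢} {ℓ} A =
  (∃₂ λ x y → ¬ (x ≈ y)) ×
  ((I : Set ℓ) (𝒜 : I → Algebra 𝓢 ℓ) (α : Hom A (Π I 𝒜)) →
    IsEmbedding α →
    (∀ i → Surjective _≈_ (Algebra._≈_ (𝒜 i)) (λ a → to α a i)) →
    ∃ λ i → Bijective _≈_ (Algebra._≈_ (𝒜 i)) (λ a → to α a i))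
  where open Algebra A using (_≈_)

InjectiveIn : Class 𝓢 ℓ → Algebra 𝓢 ℓ → Set (lsuc ℓ)
InjectiveIn 𝒦 C =
  𝒦 C ×
  (∀ A B → 𝒦 A → 𝒦 B → (e : A ↪ B) (h : Hom A C) →
    Σ[ g ∈ Hom B C ] (∀ a → to g (to (proj₁ e) a) ≈ to h a))
  where open Algebra C using (_≈_)

EnoughInjectives : Class 𝓢 ℓ → Set (lsuc ℓ)
EnoughInjectives 𝒦 = ∀ A → 𝒦 A → ∃ λ C → InjectiveIn 𝒦 C × (A ↪ C)

CongruenceExtensionProperty : Class 𝓢 ℓ → Set (lsuc ℓ)
CongruenceExtensionProperty 𝒦 =
  ∀ B → 𝒦 B → (U : Subuniverse B) (θ : Congruence (subalgebra B U)) →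
  Σ[ Θ ∈ Congruence B ] (∀ x y →
    (Congruence._θ_ θ x y → Congruence._θ_ Θ (proj₁ x) (proj₁ y)) ×
    (Congruence._θ_ Θ (proj₁ x) (proj₁ y) → Congruence._θ_ θ x y))

AmalgamationProperty : Class 𝓢 ℓ → Set (lsuc ℓ)
AmalgamationProperty 𝒦 =
  ∀ A B C → 𝒦 A → 𝒦 B → 𝒦 C → (f : A ↪ B) (g : A ↪ C) →
  ∃ λ D → 𝒦 D × (Σ[ h ∈ B ↪ D ] Σ[ k ∈ C ↪ D ] (∀ a →
    Algebra._≈_ D (to (proj₁ h) (to (proj₁ f) a)) (to (proj₁ k) (to (proj₁ g) a))))

------------------------------------------------------------------------
-- The set Jₙ with its two orders and the associated lattice operations.

data J (ℓ : Level) (n : ℕ) : Set ℓ where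
  ⊤ ⊥ : J ℓ n
  f t : Fin (suc n) → J ℓ n

module _ {n : ℕ} where

  private
    module Mx = Max (Fin.≤-totalOrder (suc n))
    module Mn = Min (Fin.≤-totalOrder (suc n))

  max min : Fin (suc n) → Fin (suc n) → Fin (suc n)
  max = Mx._⊔_
  min = Mn._⊓_

  infix 4 _≤ₖ_ _≤ₜ_

  data _≤ₖ_ {ℓ} : Rel (J ℓ n) ℓ where
    ⊥≤ : ∀ {x} → ⊥ ≤ₖ x
    ≤⊤ : ∀ {x} → x ≤ₖ ⊤
    f≤f : ∀ {i j} → j ≤ i → f i ≤ₖ f j
    t≤t : ∀ {i j} → j ≤ i → t i ≤ₖ t j

  data _≤ₜ_ {ℓ} : Rel (J ℓ n) ℓ where
    f≤f : ∀ {i j} → i ≤ j → f i ≤ₜ f j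
    f≤⊤ : ∀ {i} → f i ≤ₜ ⊤
    f≤⊥ : ∀ {i} → f i ≤ₜ ⊥
    f≤t : ∀ {i j} → f i ≤ₜ t j
    ⊤≤⊤ : ⊤ ≤ₜ ⊤
    ⊥≤⊥ : ⊥ ≤ₜ ⊥
    ⊤≤t : ∀ {j} → ⊤ ≤ₜ t j
    ⊥≤t : ∀ {j} → ⊥ ≤ₜ t j
    t≤t : ∀ {i j} → j ≤ i → t i ≤ₜ t j

  infixl 7 _⊗_ _∧_
  infixl 6 _⊕_ _∨_

  _⊗_ _⊕_ _∧_ _∨_ : J ℓ n → J ℓ n → J ℓ n

  ⊤   ⊗ y   = y
  ⊥   ⊗ y   = ⊥
  f i ⊗ ⊤   = f i
  f i ⊗ ⊥   = ⊥
  f i ⊗ f j = f (max i j)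
  f i ⊗ t j = ⊥
  t i ⊗ ⊤   = t i
  t i ⊗ ⊥   = ⊥
  t i ⊗ f j = ⊥
  t i ⊗ t j = t (max i j)

  ⊤   ⊕ y   = ⊤
  ⊥   ⊕ y   = y
  f i ⊕ ⊤   = ⊤
  f i ⊕ ⊥   = f i
  f i ⊕ f j = f (min i j)
  f i ⊕ t j = ⊤
  t i ⊕ ⊤   = ⊤
  t i ⊕ ⊥   = t i
  t i ⊕ f j = ⊤
  t i ⊕ t j = t (min i j)

  ⊤   ∧ ⊤   = ⊤
  ⊤   ∧ ⊥   = f (fromℕ n)
  ⊤   ∧ f j = f j
  ⊤   ∧ t j = ⊤
  ⊥   ∧ ⊤   = f (fromℕ n)
  ⊥   ∧ ⊥   = ⊥
  ⊥   ∧ f j = f j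
  ⊥   ∧ t j = ⊥
  f i ∧ ⊤   = f i
  f i ∧ ⊥   = f i
  f i ∧ f j = f (min i j)
  f i ∧ t j = f i
  t i ∧ ⊤   = ⊤
  t i ∧ ⊥   = ⊥
  t i ∧ f j = f j
  t i ∧ t j = t (max i j)

  ⊤   ∨ ⊤   = ⊤
  ⊤   ∨ ⊥   = t (fromℕ n)
  ⊤   ∨ f j = ⊤
  ⊤   ∨ t j = t j
  ⊥   ∨ ⊤   = t (fromℕ n)
  ⊥   ∨ ⊥   = ⊥
  ⊥   ∨ f j = ⊥
  ⊥   ∨ t j = t j
  f i ∨ ⊤   = ⊤
  f i ∨ ⊥   = ⊥
  f i ∨ f j = f (max i j)
  f i ∨ t j = t j
  t i ∨ ⊤   = t i
  t i ∨ ⊥   = t i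
  t i ∨ f j = t i
  t i ∨ t j = t (min i j)

  neg : J ℓ n → J ℓ n
  neg ⊤     = ⊤
  neg ⊥     = ⊥
  neg (f i) = t i
  neg (t i) = f i

  -- The tables above are the meets and joins of the two orders.

  ≤ₖ-isLattice : IsLattice {A = J ℓ n} _≡_ _≤ₖ_ _⊕_ _⊗_
  ≤ₖ-isLattice {ℓ} = record
    { isPartialOrder = record
      { isPreorder = record
        { isEquivalence = ≡-isEquivalence
        ; reflexive     = λ { refl → rfl _ }
        ; trans         = tr
        }
      ; antisym    = asym
      }
    ; supremum = λ x y → ub₁ x y , ub₂ x y , lub x y
    ; infimum  = λ x y → lb₁ x y , lb₂ x y , glb x y
    }
    where
    rfl : (x : J ℓ n) → x ≤ₖ x
    rfl ⊤     = ≤⊤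
    rfl ⊥     = ⊥≤
    rfl (f i) = f≤f Fin.≤-refl
    rfl (t i) = t≤t Fin.≤-refl

    tr : {x y z : J ℓ n} → x ≤ₖ y → y ≤ₖ z → x ≤ₖ z
    tr ⊥≤      q       = ⊥≤
    tr p       ≤⊤      = ≤⊤
    tr (f≤f p) (f≤f q) = f≤f (Fin.≤-trans q p)
    tr (t≤t p) (t≤t q) = t≤t (Fin.≤-trans q p)

    asym : {x y : J ℓ n} → x ≤ₖ y → y ≤ₖ x → x ≡ y
    asym ⊥≤      ⊥≤      = refl
    asym ≤⊤      ≤⊤      = refl
    asym (f≤f p) (f≤f q) = cong f (Fin.≤-antisym q p)
    asym (t≤t p) (t≤t q) = cong t (Fin.≤-antisym q p)

    ub₁ : (x y : J ℓ n) → x ≤ₖ x ⊕ y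
    ub₁ ⊤     y     = ≤⊤
    ub₁ ⊥     y     = ⊥≤
    ub₁ (f i) ⊤     = ≤⊤
    ub₁ (f i) ⊥     = rfl _
    ub₁ (f i) (f j) = f≤f (Mn.x⊓y≤x i j)
    ub₁ (f i) (t j) = ≤⊤
    ub₁ (t i) ⊤     = ≤⊤
    ub₁ (t i) ⊥     = rfl _
    ub₁ (t i) (f j) = ≤⊤
    ub₁ (t i) (t j) = t≤t (Mn.x⊓y≤x i j)

    ub₂ : (x y : J ℓ n) → y ≤ₖ x ⊕ y
    ub₂ ⊤     y     = ≤⊤
    ub₂ ⊥     y     = rfl y
    ub₂ (f i) ⊤     = ≤⊤
    ub₂ (f i) ⊥     = ⊥≤
    ub₂ (f i) (f j) = f≤f (Mn.x⊓y≤y i j)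
    ub₂ (f i) (t j) = ≤⊤
    ub₂ (t i) ⊤     = ≤⊤
    ub₂ (t i) ⊥     = ⊥≤
    ub₂ (t i) (f j) = ≤⊤
    ub₂ (t i) (t j) = t≤t (Mn.x⊓y≤y i j)

    lub : (x y z : J ℓ n) → x ≤ₖ z → y ≤ₖ z → x ⊕ y ≤ₖ z
    lub x     y     .⊤ ≤⊤      q       = ≤⊤
    lub .⊥    y     z  ⊥≤      q       = q
    lub (f i) .⊥    _  (f≤f p) ⊥≤      = f≤f p
    lub (f i) (f j) _  (f≤f p) (f≤f q) = f≤f (Mn.⊓-glb p q)
    lub (t i) .⊥    _  (t≤t p) ⊥≤      = t≤t p
    lub (t i) (t j) _  (t≤t p) (t≤t q) = t≤t (Mn.⊓-glb p q)

    lb₁ : (x y : J ℓ n) → x ⊗ y ≤ₖ x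
    lb₁ ⊤     y     = ≤⊤
    lb₁ ⊥     y     = ⊥≤
    lb₁ (f i) ⊤     = rfl _
    lb₁ (f i) ⊥     = ⊥≤
    lb₁ (f i) (f j) = f≤f (Mx.x≤x⊔y i j)
    lb₁ (f i) (t j) = ⊥≤
    lb₁ (t i) ⊤     = rfl _
    lb₁ (t i) ⊥     = ⊥≤
    lb₁ (t i) (f j) = ⊥≤
    lb₁ (t i) (t j) = t≤t (Mx.x≤x⊔y i j)

    lb₂ : (x y : J ℓ n) → x ⊗ y ≤ₖ y
    lb₂ ⊤     y     = rfl y
    lb₂ ⊥     y     = ⊥≤
    lb₂ (f i) ⊤     = ≤⊤
    lb₂ (f i) ⊥     = ⊥≤
    lb₂ (f i) (f j) = f≤f (Mx.x≤y⊔x i j)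
    lb₂ (f i) (t j) = ⊥≤
    lb₂ (t i) ⊤     = ≤⊤
    lb₂ (t i) ⊥     = ⊥≤
    lb₂ (t i) (f j) = ⊥≤
    lb₂ (t i) (t j) = t≤t (Mx.x≤y⊔x i j)

    glb : (x y z : J ℓ n) → z ≤ₖ x → z ≤ₖ y → z ≤ₖ x ⊗ y
    glb x     y     .⊥ ⊥≤      q       = ⊥≤
    glb .⊤    y     z  ≤⊤      q       = q
    glb (f i) .⊤    _  (f≤f p) ≤⊤      = f≤f p
    glb (f i) (f j) _  (f≤f p) (f≤f q) = f≤f (Mx.⊔-lub p q)
    glb (t i) .⊤    _  (t≤t p) ≤⊤      = t≤t p
    glb (t i) (t j) _  (t≤t p) (t≤t q) = t≤t (Mx.⊔-lub p q)

  ≤ₜ-isLattice : IsLattice {A = J ℓ n} _≡_ _≤ₜ_ _∨_ _∧_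
  ≤ₜ-isLattice {ℓ} = record
    { isPartialOrder = record
      { isPreorder = record
        { isEquivalence = ≡-isEquivalence
        ; reflexive     = λ { refl → rfl _ }
        ; trans         = tr
        }
      ; antisym    = asym
      }
    ; supremum = λ x y → ub₁ x y , ub₂ x y , lub x y
    ; infimum  = λ x y → lb₁ x y , lb₂ x y , glb x y
    }
    where
    rfl : (x : J ℓ n) → x ≤ₜ x
    rfl ⊤     = ⊤≤⊤
    rfl ⊥     = ⊥≤⊥
    rfl (f i) = f≤f Fin.≤-refl
    rfl (t i) = t≤t Fin.≤-refl

    tr : {x y z : J ℓ n} → x ≤ₜ y → y ≤ₜ z → x ≤ₜ z
    tr (f≤f p) (f≤f q) = f≤f (Fin.≤-trans p q)
    tr (f≤f p) f≤⊤     = f≤⊤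
    tr (f≤f p) f≤⊥     = f≤⊥
    tr (f≤f p) f≤t     = f≤t
    tr f≤⊤     ⊤≤⊤     = f≤⊤
    tr f≤⊤     ⊤≤t     = f≤t
    tr f≤⊥     ⊥≤⊥     = f≤⊥
    tr f≤⊥     ⊥≤t     = f≤t
    tr f≤t     (t≤t q) = f≤t
    tr ⊤≤⊤     q       = q
    tr ⊥≤⊥     q       = q
    tr ⊤≤t     (t≤t q) = ⊤≤t
    tr ⊥≤t     (t≤t q) = ⊥≤t
    tr (t≤t p) (t≤t q) = t≤t (Fin.≤-trans q p)

    asym : {x y : J ℓ n} → x ≤ₜ y → y ≤ₜ x → x ≡ y
    asym (f≤f p) (f≤f q) = cong f (Fin.≤-antisym p q)
    asym ⊤≤⊤     q       = refl
    asym ⊥≤⊥     q       = refl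
    asym (t≤t p) (t≤t q) = cong t (Fin.≤-antisym q p)

    fₙ-max : ∀ i → i ≤ fromℕ n
    fₙ-max = Fin.≤fromℕ

    ub₁ : (x y : J ℓ n) → x ≤ₜ x ∨ y
    ub₁ ⊤     ⊤     = ⊤≤⊤
    ub₁ ⊤     ⊥     = ⊤≤t
    ub₁ ⊤     (f j) = ⊤≤⊤
    ub₁ ⊤     (t j) = ⊤≤t
    ub₁ ⊥     ⊤     = ⊥≤t
    ub₁ ⊥     ⊥     = ⊥≤⊥
    ub₁ ⊥     (f j) = ⊥≤⊥
    ub₁ ⊥     (t j) = ⊥≤t
    ub₁ (f i) ⊤     = f≤⊤
    ub₁ (f i) ⊥     = f≤⊥
    ub₁ (f i) (f j) = f≤f (Mx.x≤x⊔y i j)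
    ub₁ (f i) (t j) = f≤t
    ub₁ (t i) ⊤     = rfl _
    ub₁ (t i) ⊥     = rfl _
    ub₁ (t i) (f j) = rfl _
    ub₁ (t i) (t j) = t≤t (Mn.x⊓y≤x i j)

    ub₂ : (x y : J ℓ n) → y ≤ₜ x ∨ y
    ub₂ ⊤     ⊤     = ⊤≤⊤
    ub₂ ⊤     ⊥     = ⊥≤t
    ub₂ ⊤     (f j) = f≤⊤
    ub₂ ⊤     (t j) = rfl _
    ub₂ ⊥     ⊤     = ⊤≤t
    ub₂ ⊥     ⊥     = ⊥≤⊥
    ub₂ ⊥     (f j) = f≤⊥
    ub₂ ⊥     (t j) = rfl _
    ub₂ (f i) ⊤     = ⊤≤⊤
    ub₂ (f i) ⊥     = ⊥≤⊥
    ub₂ (f i) (f j) = f≤f (Mx.x≤y⊔x i j)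
    ub₂ (f i) (t j) = rfl _
    ub₂ (t i) ⊤     = ⊤≤t
    ub₂ (t i) ⊥     = ⊥≤t
    ub₂ (t i) (f j) = f≤t
    ub₂ (t i) (t j) = t≤t (Mn.x⊓y≤y i j)

    lub : (x y z : J ℓ n) → x ≤ₜ z → y ≤ₜ z → x ∨ y ≤ₜ z
    lub ⊤     ⊤     z  p       q       = q
    lub ⊤     ⊥     _  ⊤≤t     q       = t≤t (fₙ-max _)
    lub ⊤     (f j) z  p       q       = p
    lub ⊤     (t j) z  p       q       = q
    lub ⊥     ⊤     _  ⊥≤t     q       = t≤t (fₙ-max _)
    lub ⊥     ⊥     z  p       q       = q
    lub ⊥     (f j) z  p       q       = p
    lub ⊥     (t j) z  p       q       = q
    lub (f i) ⊤     z  p       q       = q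
    lub (f i) ⊥     z  p       q       = q
    lub (f i) (f j) _  (f≤f p) (f≤f q) = f≤f (Mx.⊔-lub p q)
    lub (f i) (f j) _  f≤⊤     q       = f≤⊤
    lub (f i) (f j) _  f≤⊥     q       = f≤⊥
    lub (f i) (f j) _  f≤t     q       = f≤t
    lub (f i) (t j) z  p       q       = q
    lub (t i) ⊤     z  p       q       = p
    lub (t i) ⊥     z  p       q       = p
    lub (t i) (f j) z  p       q       = p
    lub (t i) (t j) _  (t≤t p) (t≤t q) = t≤t (Mn.⊓-glb p q)

    lb₁ : (x y : J ℓ n) → x ∧ y ≤ₜ x
    lb₁ ⊤     ⊤     = ⊤≤⊤
    lb₁ ⊤     ⊥     = f≤⊤
    lb₁ ⊤     (f j) = f≤⊤
    lb₁ ⊤     (t j) = ⊤≤⊤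
    lb₁ ⊥     ⊤     = f≤⊥
    lb₁ ⊥     ⊥     = ⊥≤⊥
    lb₁ ⊥     (f j) = f≤⊥
    lb₁ ⊥     (t j) = ⊥≤⊥
    lb₁ (f i) ⊤     = rfl _
    lb₁ (f i) ⊥     = rfl _
    lb₁ (f i) (f j) = f≤f (Mn.x⊓y≤x i j)
    lb₁ (f i) (t j) = rfl _
    lb₁ (t i) ⊤     = ⊤≤t
    lb₁ (t i) ⊥     = ⊥≤t
    lb₁ (t i) (f j) = f≤t
    lb₁ (t i) (t j) = t≤t (Mx.x≤x⊔y i j)

    lb₂ : (x y : J ℓ n) → x ∧ y ≤ₜ y
    lb₂ ⊤     ⊤     = ⊤≤⊤
    lb₂ ⊤     ⊥     = f≤⊥
    lb₂ ⊤     (f j) = rfl _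
    lb₂ ⊤     (t j) = ⊤≤t
    lb₂ ⊥     ⊤     = f≤⊤
    lb₂ ⊥     ⊥     = ⊥≤⊥
    lb₂ ⊥     (f j) = rfl _
    lb₂ ⊥     (t j) = ⊥≤t
    lb₂ (f i) ⊤     = f≤⊤
    lb₂ (f i) ⊥     = f≤⊥
    lb₂ (f i) (f j) = f≤f (Mn.x⊓y≤y i j)
    lb₂ (f i) (t j) = f≤t
    lb₂ (t i) ⊤     = ⊤≤⊤
    lb₂ (t i) ⊥     = ⊥≤⊥
    lb₂ (t i) (f j) = rfl _
    lb₂ (t i) (t j) = t≤t (Mx.x≤y⊔x i j)

    glb : (x y z : J ℓ n) → z ≤ₜ x → z ≤ₜ y → z ≤ₜ x ∧ y
    glb ⊤     ⊤     z  p       q       = q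
    glb ⊤     ⊥     _  f≤⊤     q       = f≤f (fₙ-max _)
    glb ⊤     (f j) z  p       q       = q
    glb ⊤     (t j) z  p       q       = p
    glb ⊥     ⊤     _  f≤⊥     q       = f≤f (fₙ-max _)
    glb ⊥     ⊥     z  p       q       = q
    glb ⊥     (f j) z  p       q       = q
    glb ⊥     (t j) z  p       q       = p
    glb (f i) ⊤     z  p       q       = p
    glb (f i) ⊥     z  p       q       = p
    glb (f i) (f j) _  (f≤f p) (f≤f q) = f≤f (Mn.⊓-glb p q)
    glb (f i) (t j) z  p       q       = p
    glb (t i) ⊤     z  p       q       = q
    glb (t i) ⊥     z  p       q       = q
    glb (t i) (f j) z  p       q       = q
    glb (t i) (t j) _  (t≤t p) (t≤t q) = t≤t (Mx.⊔-lub p q)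
    glb (t i) (t j) _  f≤t     q       = f≤t
    glb (t i) (t j) _  ⊤≤t     q       = ⊤≤t
    glb (t i) (t j) _  ⊥≤t     q       = ⊥≤t

------------------------------------------------------------------------
-- The algebras.

data Symbol (n : ℕ) : Set where
  ⊗ˢ ⊕ˢ ∧ˢ ∨ˢ ¬ˢ ⊤ˢ ⊥ˢ : Symbol n
  fˢ tˢ : Fin (suc n) → Symbol n

sig : ℕ → Signature
sig n = record { Op = Symbol n ; arity = ar }
  where
  ar : Symbol n → ℕ
  ar ⊗ˢ     = 2
  ar ⊕ˢ     = 2
  ar ∧ˢ     = 2
  ar ∨ˢ     = 2
  ar ¬ˢ     = 1
  ar ⊤ˢ     = 0
  ar ⊥ˢ     = 0
  ar (fˢ _) = 0
  ar (tˢ _) = 0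

-- The algebra in the signature of 𝐉 n with universe and operations those
-- of Jₘ, in which the constants fᵢ and tᵢ are interpreted by the elements
-- of Jₘ with index σ i.
reindexed : (n m : ℕ) → (Fin (suc n) → Fin (suc m)) → Algebra (sig n) ℓ
reindexed {ℓ} n m σ = record
  { domain  = setoid (J ℓ m)
  ; op      = ⟦op⟧
  ; op-cong = ⟦op⟧-cong
  }
  where
  ⟦op⟧ : (o : Symbol n) → (Fin (arity (sig n) o) → J ℓ m) → J ℓ m
  ⟦op⟧ ⊗ˢ     xs = xs 0F ⊗ xs 1F
  ⟦op⟧ ⊕ˢ     xs = xs 0F ⊕ xs 1F
  ⟦op⟧ ∧ˢ     xs = xs 0F ∧ xs 1F
  ⟦op⟧ ∨ˢ     xs = xs 0F ∨ xs 1F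
  ⟦op⟧ ¬ˢ     xs = neg (xs 0F)
  ⟦op⟧ ⊤ˢ     xs = ⊤
  ⟦op⟧ ⊥ˢ     xs = ⊥
  ⟦op⟧ (fˢ i) xs = f (σ i)
  ⟦op⟧ (tˢ i) xs = t (σ i)

  ⟦op⟧-cong : ∀ o {xs ys} → (∀ i → xs i ≡ ys i) → ⟦op⟧ o xs ≡ ⟦op⟧ o ys
  ⟦op⟧-cong ⊗ˢ     p = cong₂ _⊗_ (p 0F) (p 1F)
  ⟦op⟧-cong ⊕ˢ     p = cong₂ _⊕_ (p 0F) (p 1F)
  ⟦op⟧-cong ∧ˢ     p = cong₂ _∧_ (p 0F) (p 1F)
  ⟦op⟧-cong ∨ˢ     p = cong₂ _∨_ (p 0F) (p 1F)
  ⟦op⟧-cong ¬ˢ     p = cong neg (p 0F)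
  ⟦op⟧-cong ⊤ˢ     p = refl
  ⟦op⟧-cong ⊥ˢ     p = refl
  ⟦op⟧-cong (fˢ i) p = refl
  ⟦op⟧-cong (tˢ i) p = refl

𝐉 : (n : ℕ) → Algebra (sig n) ℓ
𝐉 n = reindexed n n id

𝐉₀ : (n : ℕ) → Algebra (sig n) ℓ
𝐉₀ n = reindexed n 0 (const zero)

-- Meaningful for 1 ≤ k ≤ n.  The elements 𝟎, f, 𝟏, t of the universe are
-- f 0F, f 1F, t 0F, t 1F here.
𝐉₁ : (n k : ℕ) → Algebra (sig n) ℓ
𝐉₁ n k = reindexed n 1 (λ i → if toℕ i <ᵇ k then 0F else 1F)

𝓥 : (n : ℕ) → Class (sig n) ℓ
𝓥 n = HSP (𝐉 n)

{-# OPTIONS --safe #-}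

-- The truth order of an algebra A satisfying the identities of 𝐉 n is a
-- distributive lattice.  If (c , d) is a prime pair of Jₙ (every element
-- is above c or below d, and not both), then a homomorphism from A to
-- the subdirectly irreducible algebra M determined by (c , d) amounts to a
-- prime filter of A that contains the constant c and not the constant d.
-- The pairs are (⊤ , ⊥) and (⊥ , ⊤), which give 𝐉₀ n, and (tₖ₋₁ , tₖ) and
-- (fₖ , fₖ₋₁), which give 𝐉₁ n k; every prime filter omitting f₀ and
-- containing t₀ belongs to one of them.  Hence homomorphisms into these
-- algebras separate the elements of A, and they extend from subalgebras
-- because prime filters do.
module Submission where

open import Defs
open import Algebra.Lattice.Bundles using () renaming (Lattice to AlgLattice)
import Algebra.Construct.NaturalChoice.Max as Max
import Algebra.Construct.NaturalChoice.Min as Min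
import Algebra.Lattice.Properties.Lattice as LatticeProperties
open import Axiom.ExcludedMiddle using (ExcludedMiddle)
open import Data.Bool.Base using (Bool; true; false; if_then_else_; T; not)
open import Data.Bool.Properties as Bool using (⇔→≡; ¬-not)
open import Data.Fin.Base using (Fin; zero; suc; fromℕ; fromℕ<; toℕ; inject₁; combine; remQuot)
  renaming (_≤_ to _≤ᶠ_)
open import Data.Fin.Patterns using (0F; 1F; 2F; 3F; 4F; 5F)
import Data.Fin.Properties as Fin
open import Data.Nat.Base as ℕ using (ℕ; zero; suc; _≤_; _<_; _<ᵇ_; z≤n; s≤s)
import Data.Nat.Properties as ℕ
open import Data.Product.Base using (∃; ∃₂; Σ-syntax; _×_; _,_; proj₁; proj₂)
open import Data.Sum.Base as Sum using (_⊎_; inj₁; inj₂; swap; [_,_]′)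
open import Data.Unit.Polymorphic.Base using (tt) renaming (⊤ to Unit)
open import Data.Vec.Base using (Vec; []; _∷_; lookup; tabulate)
open import Data.Vec.Properties using (tabulate-cong)
open import Function.Base using (_∘_; id; case_of_; const)
open import Function.Bundles using (Inverse; mk⇔; mk↔ₛ′)
open import Function.Definitions using (Surjective; Bijective)
open import Level using (Level; 0ℓ) renaming (_⊔_ to _⊔ˡ_)
open import Relation.Binary.Bundles using (Poset; Setoid)
open import Relation.Binary.Definitions using (tri<; tri≈; tri>)
open import Relation.Binary.Lattice.Bundles using (DistributiveLattice)
  renaming (Lattice to OrderLattice)
import Relation.Binary.Lattice.Properties.Lattice as OrderLatticeProperties
open import Relation.Binary.PropositionalEquality using (_≡_; refl; sym; trans; cong; cong₂; subst)
open import Relation.Binary.PropositionalEquality.Properties using (setoid)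
open import Relation.Nullary.Decidable using (yes; no; does; decidable-stable; dec-true)
open import Relation.Nullary.Negation using (¬_; contradiction)
open import Relation.Unary using (Pred)

open Algebra using (domain; Carrier; op; op-cong)
open Hom using (to; preserves)

-- Membership in the variety enters only through the identities of `𝐉 n`, which also hold in the
-- subalgebras and quotients formed on the way. The obstacle is that `⊗`, `⊕` and `neg` are not
-- lattice operations of the truth order, so nothing obvious makes a prime filter respect them. Two
-- devices remove it. An element of M is determined by the `χ`-values of a few unary terms. And any
-- finite pattern of memberships in a prime filter of A that contains c and omits d is realized in
-- `𝐉 n` by one assignment: otherwise the meet of the terms inside the filter would lie below the
-- join of the terms outside it throughout `𝐉 n`, hence also in A. An operation together with its
-- arguments involves only finitely many terms, so the decoded filter preserves all operations
-- uniformly. Zorn's lemma serves only to extend a filter disjoint from an ideal to a prime one.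

private
  variable
    ℓ : Level
    𝓢 : Signature
    k k′ m n p q : ℕ
    A B C : Algebra 𝓢 ℓ

-- Terms and identities

data Term (𝓢 : Signature) (m : ℕ) : Set where
  var : Fin m → Term 𝓢 m
  app : (o : Op 𝓢) → Vec (Term 𝓢 m) (arity 𝓢 o) → Term 𝓢 m

module _ (A : Algebra 𝓢 ℓ) where

  eval  : (Fin m → Carrier A) → Term 𝓢 m → Carrier A
  evals : (Fin m → Carrier A) → Vec (Term 𝓢 m) k → Vec (Carrier A) k
  eval ρ (var i)    = ρ i
  eval ρ (app o ts) = op A o (lookup (evals ρ ts))
  evals ρ []        = []
  evals ρ (s ∷ ss)  = eval ρ s ∷ evals ρ ss

_[_] : Term 𝓢 k → (Fin k → Term 𝓢 m) → Term 𝓢 m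
substs : Vec (Term 𝓢 k) n → (Fin k → Term 𝓢 m) → Vec (Term 𝓢 m) n
var i [ σ ]        = σ i
app o ss [ σ ]     = app o (substs ss σ)
substs [] σ        = []
substs (s ∷ ss) σ  = s [ σ ] ∷ substs ss σ

module _ (A : Algebra 𝓢 ℓ) where
  open Setoid (domain A) using (_≈_) renaming (refl to ≈-refl)

  eval-cong  : {ρ σ : Fin m → Carrier A} → (∀ i → ρ i ≈ σ i) →
               ∀ s → eval A ρ s ≈ eval A σ s
  evals-cong : {ρ σ : Fin m → Carrier A} → (∀ i → ρ i ≈ σ i) →
               ∀ (ss : Vec (Term 𝓢 m) k) j → lookup (evals A ρ ss) j ≈ lookup (evals A σ ss) j
  eval-cong p (var i)    = p i
  eval-cong p (app o ss) = op-cong A o (evals-cong p ss)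
  evals-cong p (s ∷ ss) Fin.zero    = eval-cong p s
  evals-cong p (s ∷ ss) (Fin.suc j) = evals-cong p ss j

  eval-[]  : ∀ (ρ : Fin m → Carrier A) (s : Term 𝓢 k) σ →
             eval A ρ (s [ σ ]) ≈ eval A (λ i → eval A ρ (σ i)) s
  evals-[] : ∀ (ρ : Fin m → Carrier A) (ss : Vec (Term 𝓢 k) n) σ j →
             lookup (evals A ρ (substs ss σ)) j ≈ lookup (evals A (λ i → eval A ρ (σ i)) ss) j
  eval-[] ρ (var i)    σ = ≈-refl
  eval-[] ρ (app o ss) σ = op-cong A o (evals-[] ρ ss σ)
  evals-[] ρ (s ∷ ss) σ Fin.zero    = eval-[] ρ s σ
  evals-[] ρ (s ∷ ss) σ (Fin.suc j) = evals-[] ρ ss σ j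

  evals-tabulate : ∀ (ρ : Fin m → Carrier A) (σ : Fin k → Term 𝓢 m) j →
                   lookup (evals A ρ (tabulate σ)) j ≈ eval A ρ (σ j)
  evals-tabulate ρ σ Fin.zero    = ≈-refl
  evals-tabulate ρ σ (Fin.suc j) = evals-tabulate ρ (σ ∘ Fin.suc) j

module _ {A B : Algebra 𝓢 ℓ} (h : Hom A B) where
  open Setoid (domain B) using (_≈_) renaming (refl to ≈-refl; trans to ≈-trans)

  hom-eval  : ∀ (ρ : Fin m → Carrier A) s → to h (eval A ρ s) ≈ eval B (to h ∘ ρ) s
  hom-evals : ∀ (ρ : Fin m → Carrier A) (ss : Vec (Term 𝓢 m) k) j →
              to h (lookup (evals A ρ ss) j) ≈ lookup (evals B (to h ∘ ρ) ss) j
  hom-eval ρ (var i)    = ≈-refl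
  hom-eval ρ (app o ss) = ≈-trans (preserves h o _) (op-cong B o (hom-evals ρ ss))
  hom-evals ρ (s ∷ ss) Fin.zero    = hom-eval ρ s
  hom-evals ρ (s ∷ ss) (Fin.suc j) = hom-evals ρ ss j

_∘ʰ_ : Hom B C → Hom A B → Hom A C
_∘ʰ_ {C = C} g h = record
  { func = record { to = to g ∘ to h ; cong = Hom.cong g ∘ Hom.cong h }
  ; preserves = λ o xs →
      Setoid.trans (domain C) (Hom.cong g (preserves h o xs)) (preserves g o _)
  }

module _ {I : Set ℓ} (𝒜 : I → Algebra 𝓢 ℓ) where

  projection : ∀ i → Hom (Π I 𝒜) (𝒜 i)
  projection i = record
    { func = record { to = λ x → x i ; cong = λ p → p i }
    ; preserves = λ o xs → Setoid.refl (domain (𝒜 i))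
    }

  tuple : (∀ i → Hom A (𝒜 i)) → Hom A (Π I 𝒜)
  tuple h = record
    { func = record { to = λ x i → to (h i) x ; cong = λ p i → Hom.cong (h i) p }
    ; preserves = λ o xs i → preserves (h i) o xs
    }

inclusion : (U : Subuniverse A) → Hom (subalgebra A U) A
inclusion {A = A} U = record
  { func = record { to = proj₁ ; cong = id }
  ; preserves = λ o xs → Setoid.refl (domain A)
  }

record Satisfies (J A : Algebra 𝓢 ℓ) : Set ℓ where
  field
    identity : ∀ {m} (s r : Term 𝓢 m) →
      (∀ ρ → Algebra._≈_ J (eval J ρ s) (eval J ρ r)) →
      ∀ ρ → Algebra._≈_ A (eval A ρ s) (eval A ρ r)

open Satisfies

satisfies-subdirect : ∀ {i} {J A : Algebra 𝓢 ℓ} {I : Set i} (ℬ : I → Algebra 𝓢 ℓ)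
  (h : ∀ i → Hom A (ℬ i)) →
  (∀ {x y} → (∀ i → Algebra._≈_ (ℬ i) (to (h i) x) (to (h i) y)) → Algebra._≈_ A x y) →
  (∀ i → Satisfies J (ℬ i)) → Satisfies J A
satisfies-subdirect ℬ h inj sat .identity s r eq ρ = inj λ i →
  let open Setoid (domain (ℬ i)) using () renaming (trans to ≈-trans; sym to ≈-sym) in
  ≈-trans (hom-eval (h i) ρ s) (≈-trans (sat i .identity s r eq _) (≈-sym (hom-eval (h i) ρ r)))

satisfies-image : {J A B : Algebra 𝓢 ℓ} (h : Hom A B) → IsSurjective h →
  Satisfies J A → Satisfies J B
satisfies-image {A = A} {B} h surj sat .identity s r eq ρ =
  ≈-trans (≈-sym (lift s)) (≈-trans (Hom.cong h (sat .identity s r eq σ)) (lift r))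
  where
  open Setoid (domain B) using (_≈_) renaming (trans to ≈-trans; sym to ≈-sym)
  σ = λ i → proj₁ (surj (ρ i))
  lift : ∀ s → to h (eval A σ s) ≈ eval B ρ s
  lift s = ≈-trans (hom-eval h σ s)
    (eval-cong B (λ i → proj₂ (surj (ρ i)) (Setoid.refl (domain A))) s)

HSP-satisfies : {J A : Algebra 𝓢 ℓ} → HSP J A → Satisfies J A
HSP-satisfies {J = J} (A′ , (C , (I , 𝒜 , 𝒜≡J , g , g-inj , _) , U , e , e-inj , _) , h , h-surj) =
  satisfies-image h h-surj
    (satisfies-subdirect 𝒜 (λ i → projection 𝒜 i ∘ʰ (g ∘ʰ (inclusion U ∘ʰ e)))
      (e-inj ∘ g-inj)
      (λ i → subst (Satisfies J) (sym (𝒜≡J i)) (record { identity = λ s r eq → eq })))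

-- The prime filter theorem

module PrimeFilters {c ℓ₁ ℓ₂ : Level} (L : DistributiveLattice c ℓ₁ ℓ₂) where
  open DistributiveLattice L public
    using (∧-distribˡ-∨; reflexive; x∧y≤x; x∧y≤y; ∧-greatest; x≤x∨y; y≤x∨y; ∨-least)
    renaming (Carrier to X; _≤_ to _⊑_; _∧_ to _⊓_; _∨_ to _⊔_; refl to ⊑-refl; trans to ⊑-trans)

  -- Boolean membership can be fed to `decode` and keeps the level independent of the predicates
  -- from which a filter is built. `prime` says that the complement is closed under joins; that
  -- neither side is empty is left to each application.
  record PrimeFilter : Set (c ⊔ˡ ℓ₂) where
    field
      member : X → Bool
      upward : ∀ {x y} → x ⊑ y → member x ≡ true → member y ≡ true
      meet   : ∀ {x y} → member x ≡ true → member y ≡ true → member (x ⊓ y) ≡ true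
      prime  : ∀ {x y} → member x ≡ false → member y ≡ false → member (x ⊔ y) ≡ false

    downward : ∀ {x y} → x ⊑ y → member y ≡ false → member x ≡ false
    downward {x} x⊑y y∉ with member x in x∈
    ... | false = refl
    ... | true  = trans (sym (upward x⊑y x∈)) y∉

module PrimeFilterTheorem (em : ∀ {a} → ExcludedMiddle a)
  (zorn : ∀ {a ℓ₁ ℓ₂ c} → ZornsLemma a ℓ₁ ℓ₂ c)
  {c ℓ₁ ℓ₂ : Level} (L : DistributiveLattice c ℓ₁ ℓ₂) where
  open PrimeFilters L

  ⌊_⌋ : ∀ {p} → Set p → Bool
  ⌊ Q ⌋ = does (em {P = Q})

  holds : ∀ {p} {Q : Set p} → Q → ⌊ Q ⌋ ≡ true
  holds {Q = Q} = dec-true (em {P = Q})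

  witness : ∀ {p} {Q : Set p} → ⌊ Q ⌋ ≡ true → Q
  witness {Q = Q} eq with em {P = Q}
  ... | yes q = q

  module _ {p : Level} (F I : Pred X p)
    (F-inhabited : ∃ F) (F-meet : ∀ {x y} → F x → F y → F (x ⊓ y))
    (F-up : ∀ {x y} → x ⊑ y → F x → F y)
    (I-join : ∀ {x y} → I x → I y → I (x ⊔ y))
    (I-down : ∀ {x y} → x ⊑ y → I y → I x)
    (disjoint : ∀ {x} → F x → ¬ I x) where

    record Avoiding : Set (c ⊔ˡ ℓ₂ ⊔ˡ p) where
      field
        member : X → Bool
        above  : ∀ {x} → F x → member x ≡ true
        avoids : ∀ {x} → member x ≡ true → ¬ I x
        upward : ∀ {x y} → x ⊑ y → member x ≡ true → member y ≡ true
        meet   : ∀ {x y} → member x ≡ true → member y ≡ true → member (x ⊓ y) ≡ true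

    open Avoiding

    _⊆_ : Avoiding → Avoiding → Set c
    U ⊆ V = ∀ x → member U x ≡ true → member V x ≡ true

    avoiding : Poset (c ⊔ˡ ℓ₂ ⊔ˡ p) c c
    avoiding = record
      { Carrier = Avoiding
      ; _≈_ = λ U V → ∀ x → member U x ≡ member V x
      ; _≤_ = _⊆_
      ; isPartialOrder = record
        { isPreorder = record
          { isEquivalence = record
            { refl  = λ x → refl
            ; sym   = λ p x → sym (p x)
            ; trans = λ p q x → trans (p x) (q x)
            }
          ; reflexive = λ p x x∈ → trans (sym (p x)) x∈
          ; trans = λ p q x → q x ∘ p x
          }
        ; antisym = λ p q x → ⇔→≡ (mk⇔ (p x) (q x))
        }
      }

    chain-bound : (C : Pred Avoiding 0ℓ) → (∀ U V → C U → C V → U ⊆ V ⊎ V ⊆ U) →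
      ∃ λ W → ∀ U → C U → U ⊆ W
    chain-bound C linear = union , λ U U∈C x x∈U → holds (inj₂ (U , U∈C , x∈U))
      where
      -- Adding F itself gives the empty chain a bound as well.
      InUnion : X → Set _
      InUnion x = F x ⊎ ∃ λ U → C U × member U x ≡ true

      meet∪ : ∀ {x y} → InUnion x → InUnion y → InUnion (x ⊓ y)
      meet∪ (inj₁ Fx) (inj₁ Fy) = inj₁ (F-meet Fx Fy)
      meet∪ (inj₁ Fx) (inj₂ (V , V∈C , y∈V)) = inj₂ (V , V∈C , meet V (above V Fx) y∈V)
      meet∪ (inj₂ (U , U∈C , x∈U)) (inj₁ Fy) = inj₂ (U , U∈C , meet U x∈U (above U Fy))
      meet∪ (inj₂ (U , U∈C , x∈U)) (inj₂ (V , V∈C , y∈V)) with linear U V U∈C V∈C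
      ... | inj₁ U⊆V = inj₂ (V , V∈C , meet V (U⊆V _ x∈U) y∈V)
      ... | inj₂ V⊆U = inj₂ (U , U∈C , meet U x∈U (V⊆U _ y∈V))

      union : Avoiding
      union = record
        { member = λ x → ⌊ InUnion x ⌋
        ; above  = holds ∘ inj₁
        ; avoids = λ x∈ Ix → case witness x∈ of λ where
            (inj₁ Fx)            → disjoint Fx Ix
            (inj₂ (U , _ , x∈U)) → avoids U x∈U Ix
        ; upward = λ x⊑y x∈ → holds (case witness x∈ of λ where
            (inj₁ Fx)              → inj₁ (F-up x⊑y Fx)
            (inj₂ (U , U∈C , x∈U)) → inj₂ (U , U∈C , upward U x⊑y x∈U))
        ; meet   = λ x∈ y∈ → holds (meet∪ (witness x∈) (witness y∈))
        }

    maximal : ∃ λ M → ∀ V → M ⊆ V → ∀ x → member V x ≡ member M x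
    maximal = zorn avoiding chain-bound

    M : Avoiding
    M = proj₁ maximal

    -- A maximal filter avoiding I meets I as soon as an element is adjoined.
    adjoin : ∀ {x} → member M x ≡ false → ∃₂ λ u i → member M u ≡ true × I i × u ⊓ x ⊑ i
    adjoin {x} x∉M = decidable-stable em λ none →
      let
        -- The filter generated by M and x. Under `none` it avoids I, so maximality would put x into
        -- M.
        V : Avoiding
        V = record
          { member = λ z → ⌊ (∃ λ u → member M u ≡ true × u ⊓ x ⊑ z) ⌋
          ; above  = λ Fz → holds (_ , above M Fz , x∧y≤x _ _)
          ; avoids = λ z∈ Iz → let u , u∈ , ux⊑z = witness z∈ in none (u , _ , u∈ , Iz , ux⊑z)
          ; upward = λ y⊑z y∈ → let u , u∈ , ux⊑y = witness y∈ in
              holds (u , u∈ , ⊑-trans ux⊑y y⊑z)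
          ; meet   = λ y∈ z∈ →
              let u , u∈ , ux⊑y = witness y∈
                  v , v∈ , vx⊑z = witness z∈
              in holds (u ⊓ v , meet M u∈ v∈ , ∧-greatest
                (⊑-trans (∧-greatest (⊑-trans (x∧y≤x _ _) (x∧y≤x u v)) (x∧y≤y _ _)) ux⊑y)
                (⊑-trans (∧-greatest (⊑-trans (x∧y≤x _ _) (x∧y≤y u v)) (x∧y≤y _ _)) vx⊑z))
          }
        V≈M = proj₂ maximal V λ z z∈M → holds (z , z∈M , x∧y≤x _ _)
        x∈V = holds (_ , above M (proj₂ F-inhabited) , x∧y≤y _ x)
      in case trans (sym x∉M) (trans (sym (V≈M x)) x∈V) of λ ()

    primeFilter : Σ[ U ∈ PrimeFilter ]
      (∀ {x} → F x → PrimeFilter.member U x ≡ true) ×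
      (∀ {x} → I x → PrimeFilter.member U x ≡ false)
    primeFilter = U , above M , λ Ix → ¬-not λ x∈M → avoids M x∈M Ix
      where
      U : PrimeFilter
      U = record
        { member = member M
        ; upward = upward M
        ; meet   = meet M
        ; prime  = λ {x} {y} x∉M y∉M → ¬-not λ x⊔y∈M →
            let u , i , u∈M , Ii , ux⊑i = adjoin x∉M
                v , j , v∈M , Ij , vy⊑j = adjoin y∉M
                -- By distributivity `w ⊓ (x ⊔ y)` lies below `i ⊔ j` and hence in I, although it
                -- would belong to M.
                w = u ⊓ v
                wx⊑i⊔j = ⊑-trans (⊑-trans (∧-greatest (⊑-trans (x∧y≤x w x) (x∧y≤x u v)) (x∧y≤y w x)) ux⊑i) (x≤x∨y i j)
                wy⊑i⊔j = ⊑-trans (⊑-trans (∧-greatest (⊑-trans (x∧y≤x w y) (x∧y≤y u v)) (x∧y≤y w y)) vy⊑j) (y≤x∨y i j)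
            in avoids M (meet M (meet M u∈M v∈M) x⊔y∈M)
                 (I-down (⊑-trans (reflexive (∧-distribˡ-∨ w x y)) (∨-least wx⊑i⊔j wy⊑i⊔j))
                         (I-join Ii Ij))
        }

-- Truth lattices

infixl 7 _∧ᵗ_ _⊗ᵗ_
infixl 6 _∨ᵗ_

_∧ᵗ_ _∨ᵗ_ _⊗ᵗ_ : Term (sig n) m → Term (sig n) m → Term (sig n) m
s ∧ᵗ r = app ∧ˢ (s ∷ r ∷ [])
s ∨ᵗ r = app ∨ˢ (s ∷ r ∷ [])
s ⊗ᵗ r = app ⊗ˢ (s ∷ r ∷ [])

negᵗ : Term (sig n) m → Term (sig n) m
negᵗ s = app ¬ˢ (s ∷ [])

name : J ℓ n → Term (sig n) m
name ⊤     = app ⊤ˢ []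
name ⊥     = app ⊥ˢ []
name (f i) = app (fˢ i) []
name (t i) = app (tˢ i) []

eval-name : (ρ : Fin m → J ℓ n) (x : J ℓ n) → eval (𝐉 n) ρ (name x) ≡ x
eval-name ρ ⊤     = refl
eval-name ρ ⊥     = refl
eval-name ρ (f i) = refl
eval-name ρ (t i) = refl

constant : (A : Algebra (sig n) ℓ) → J ℓ n → Carrier A
constant A x = eval A {m = 0} (λ ()) (name x)

eval-constant : (A : Algebra (sig n) ℓ) (ρ : Fin m → Carrier A) (x : J ℓ n) →
                eval A ρ (name x) ≡ constant A x
eval-constant A ρ ⊤     = refl
eval-constant A ρ ⊥     = refl
eval-constant A ρ (f i) = refl
eval-constant A ρ (t i) = refl

module _ {ℓ : Level} {n : ℕ} where

  truthJ : OrderLattice ℓ ℓ ℓ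
  truthJ = record { isLattice = ≤ₜ-isLattice {n = n} {ℓ = ℓ} }

  open OrderLattice truthJ using () public
    renaming (refl to ≤ₜ-refl; trans to ≤ₜ-trans; antisym to ≤ₜ-antisym; reflexive to ≤ₜ-reflexive;
              x∧y≤x to ∧-lower₁; x∧y≤y to ∧-lower₂; ∧-greatest to ∧-glb;
              x≤x∨y to ∨-upper₁; y≤x∨y to ∨-upper₂; ∨-least to ∨-lub)

  module AlgJ = AlgLattice (OrderLatticeProperties.algLattice truthJ)

  -- Reduces distributivity to the one kind of pair whose join is neither of its members.
  truth-comparable : (x y : J ℓ n) → x ≤ₜ y ⊎ y ≤ₜ x ⊎ (x ≡ ⊤ × y ≡ ⊥) ⊎ (x ≡ ⊥ × y ≡ ⊤)
  truth-comparable ⊤     ⊤     = inj₁ ⊤≤⊤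
  truth-comparable ⊤     ⊥     = inj₂ (inj₂ (inj₁ (refl , refl)))
  truth-comparable ⊤     (f j) = inj₂ (inj₁ f≤⊤)
  truth-comparable ⊤     (t j) = inj₁ ⊤≤t
  truth-comparable ⊥     ⊤     = inj₂ (inj₂ (inj₂ (refl , refl)))
  truth-comparable ⊥     ⊥     = inj₁ ⊥≤⊥
  truth-comparable ⊥     (f j) = inj₂ (inj₁ f≤⊥)
  truth-comparable ⊥     (t j) = inj₁ ⊥≤t
  truth-comparable (f i) ⊤     = inj₁ f≤⊤
  truth-comparable (f i) ⊥     = inj₁ f≤⊥
  truth-comparable (f i) (t j) = inj₁ f≤t
  truth-comparable (t i) ⊤     = inj₂ (inj₁ ⊤≤t)
  truth-comparable (t i) ⊥     = inj₂ (inj₁ ⊥≤t)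
  truth-comparable (t i) (f j) = inj₂ (inj₁ f≤t)
  truth-comparable (f i) (f j) with Fin.≤-total i j
  ... | inj₁ i≤j = inj₁ (f≤f i≤j)
  ... | inj₂ j≤i = inj₂ (inj₁ (f≤f j≤i))
  truth-comparable (t i) (t j) with Fin.≤-total i j
  ... | inj₁ i≤j = inj₂ (inj₁ (t≤t i≤j))
  ... | inj₂ j≤i = inj₁ (t≤t j≤i)

  ∧-distribˡ-∨-≤ : (x y z : J ℓ n) → x ∧ (y ∨ z) ≤ₜ (x ∧ y) ∨ (x ∧ z)
  ∧-distribˡ-∨-≤ x y z with truth-comparable y z
  ... | inj₁ y≤z = ≤ₜ-trans
    (∧-glb (∧-lower₁ x _) (≤ₜ-trans (∧-lower₂ x _) (∨-lub y≤z ≤ₜ-refl))) (∨-upper₂ _ _)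
  ... | inj₂ (inj₁ z≤y) = ≤ₜ-trans
    (∧-glb (∧-lower₁ x _) (≤ₜ-trans (∧-lower₂ x _) (∨-lub ≤ₜ-refl z≤y))) (∨-upper₁ _ _)
  ∧-distribˡ-∨-≤ ⊤     y z | inj₂ (inj₂ (inj₁ (refl , refl))) = ⊤≤⊤
  ∧-distribˡ-∨-≤ ⊥     y z | inj₂ (inj₂ (inj₁ (refl , refl))) = ⊥≤⊥
  ∧-distribˡ-∨-≤ (f i) y z | inj₂ (inj₂ (inj₁ (refl , refl))) = ∨-upper₁ (f i) (f i)
  ∧-distribˡ-∨-≤ (t i) y z | inj₂ (inj₂ (inj₁ (refl , refl))) = ∧-lower₂ (t i) _
  ∧-distribˡ-∨-≤ ⊤     y z | inj₂ (inj₂ (inj₂ (refl , refl))) = ⊤≤⊤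
  ∧-distribˡ-∨-≤ ⊥     y z | inj₂ (inj₂ (inj₂ (refl , refl))) = ⊥≤⊥
  ∧-distribˡ-∨-≤ (f i) y z | inj₂ (inj₂ (inj₂ (refl , refl))) = ∨-upper₁ (f i) (f i)
  ∧-distribˡ-∨-≤ (t i) y z | inj₂ (inj₂ (inj₂ (refl , refl))) = ∧-lower₂ (t i) _

  ∧-distribˡ-∨ : (x y z : J ℓ n) → x ∧ (y ∨ z) ≡ (x ∧ y) ∨ (x ∧ z)
  ∧-distribˡ-∨ x y z = ≤ₜ-antisym (∧-distribˡ-∨-≤ x y z) (∨-lub
    (∧-glb (∧-lower₁ x y) (≤ₜ-trans (∧-lower₂ x y) (∨-upper₁ y z)))
    (∧-glb (∧-lower₁ x z) (≤ₜ-trans (∧-lower₂ x z) (∨-upper₂ y z))))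

module _ {n : ℕ} (A : Algebra (sig n) ℓ) where

  -- Written with `lookup` on vectors so that these are definitionally the values of the terms built
  -- with `∧ᵗ` and `∨ᵗ`; the identities of `𝐉 n` then yield the lattice laws without conversion.
  meetᴬ joinᴬ : Carrier A → Carrier A → Carrier A
  meetᴬ x y = op A ∧ˢ (lookup (x ∷ y ∷ []))
  joinᴬ x y = op A ∨ˢ (lookup (x ∷ y ∷ []))

  private
    cong₂ᴬ : ∀ {x x′ y y′} → Algebra._≈_ A x x′ → Algebra._≈_ A y y′ →
             ∀ i → Algebra._≈_ A (lookup (x ∷ y ∷ []) i) (lookup (x′ ∷ y′ ∷ []) i)
    cong₂ᴬ p q 0F = p
    cong₂ᴬ p q 1F = q

  truthAlgLattice : Satisfies (𝐉 n) A → AlgLattice ℓ ℓ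
  truthAlgLattice sat = record
    { _∨_ = joinᴬ
    ; _∧_ = meetᴬ
    ; isLattice = record
      { isEquivalence = Setoid.isEquivalence (domain A)
      ; ∨-comm  = λ a b → sat .identity (x ∨ᵗ y) (y ∨ᵗ x)
          (λ ρ → AlgJ.∨-comm (ρ 0F) (ρ 1F)) (lookup (a ∷ b ∷ b ∷ []))
      ; ∨-assoc = λ a b c → sat .identity (x ∨ᵗ y ∨ᵗ z) (x ∨ᵗ (y ∨ᵗ z))
          (λ ρ → AlgJ.∨-assoc (ρ 0F) (ρ 1F) (ρ 2F)) (lookup (a ∷ b ∷ c ∷ []))
      ; ∨-cong  = λ p q → op-cong A ∨ˢ (cong₂ᴬ p q)
      ; ∧-comm  = λ a b → sat .identity (x ∧ᵗ y) (y ∧ᵗ x)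
          (λ ρ → AlgJ.∧-comm (ρ 0F) (ρ 1F)) (lookup (a ∷ b ∷ b ∷ []))
      ; ∧-assoc = λ a b c → sat .identity (x ∧ᵗ y ∧ᵗ z) (x ∧ᵗ (y ∧ᵗ z))
          (λ ρ → AlgJ.∧-assoc (ρ 0F) (ρ 1F) (ρ 2F)) (lookup (a ∷ b ∷ c ∷ []))
      ; ∧-cong  = λ p q → op-cong A ∧ˢ (cong₂ᴬ p q)
      ; absorptive =
          (λ a b → sat .identity (x ∨ᵗ x ∧ᵗ y) x
            (λ ρ → AlgJ.∨-absorbs-∧ (ρ 0F) (ρ 1F)) (lookup (a ∷ b ∷ b ∷ []))) ,
          (λ a b → sat .identity (x ∧ᵗ (x ∨ᵗ y)) x
            (λ ρ → AlgJ.∧-absorbs-∨ (ρ 0F) (ρ 1F)) (lookup (a ∷ b ∷ b ∷ [])))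
      }
    }
    where
    x y z : Term (sig n) 3
    x = var 0F
    y = var 1F
    z = var 2F

  truthLattice : Satisfies (𝐉 n) A → DistributiveLattice ℓ ℓ ℓ
  truthLattice sat = record
    { isDistributiveLattice = record
      { isLattice = LatticeProperties.∨-∧-isOrderTheoreticLattice (truthAlgLattice sat)
      ; ∧-distribˡ-∨ = λ a b c → sat .identity
          (var 0F ∧ᵗ (var 1F ∨ᵗ var 2F)) (var 0F ∧ᵗ var 1F ∨ᵗ var 0F ∧ᵗ var 2F)
          (λ ρ → ∧-distribˡ-∨ (ρ 0F) (ρ 1F) (ρ 2F)) (lookup (a ∷ b ∷ c ∷ []))
      }
    }

  module _ (sat : Satisfies (𝐉 n) A) where
    open DistributiveLattice (truthLattice sat) using () renaming (_≤_ to _⊑_)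

    -- The order of `truthLattice` is given by `x ≈ x ∧ y`, so an inequality between terms is itself
    -- an identity.
    satisfies-≤ : (s r : Term (sig n) m) →
      (∀ ρ → eval (𝐉 n) ρ s ≤ₜ eval (𝐉 n) ρ r) → ∀ ρ → eval A ρ s ⊑ eval A ρ r
    satisfies-≤ s r le = sat .identity s (s ∧ᵗ r)
      λ ρ → ≤ₜ-antisym (∧-glb ≤ₜ-refl (le ρ)) (∧-lower₁ _ _)

-- Homomorphisms from prime filters

-- For a prime pair (c , d) of Jₙ, χ is the indicator on M of the image of the
-- elements above c.  An element y of M is recovered by decode from the values
-- of χ at the readings of y; applied to the membership of the same terms in a
-- prime filter of A, decode yields the homomorphism A → M.
record Separator (ℓ : Level) (n m : ℕ) (σ : Fin (suc n) → Fin (suc m)) : Set ℓ where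
  M : Algebra (sig n) ℓ
  M = reindexed n m σ
  field
    π       : Hom (𝐉 n) M
    section : ∀ y → ∃ λ x → to π x ≡ y
    c d     : J ℓ n
    split   : ∀ x → c ≤ₜ x ⊎ x ≤ₜ d
    χ       : J ℓ m → Bool
    -- Together with `χ-down` this makes the alternatives of `split` exclusive and forbids `π` to
    -- identify elements from different sides.
    χ-up    : ∀ {x} → c ≤ₜ x → χ (to π x) ≡ true
    χ-down  : ∀ {x} → x ≤ₜ d → χ (to π x) ≡ false
    {r}     : ℕ
    extra   : Vec (Term (sig n) 1) r

  readings : Fin (suc r) → Term (sig n) 1
  -- Reading 0 is the element itself; `member-filterHom` relies on it.
  readings = lookup (var 0F ∷ extra)

  field
    decode          : Vec Bool (suc r) → J ℓ m
    decode-readings : ∀ y → decode (tabulate λ j → χ (eval M (const y) (readings j))) ≡ y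

  π-surjective : IsSurjective π
  π-surjective y = proj₁ (section y) , λ { refl → proj₂ (section y) }

  χ-true : ∀ {x} → χ (to π x) ≡ true → c ≤ₜ x
  χ-true {x} eq with split x
  ... | inj₁ c≤x = c≤x
  ... | inj₂ x≤d = contradiction (trans (sym eq) (χ-down x≤d)) λ ()

  χ-false : ∀ {x} → χ (to π x) ≡ false → x ≤ₜ d
  χ-false {x} eq with split x
  ... | inj₁ c≤x = contradiction (trans (sym eq) (χ-up c≤x)) λ ()
  ... | inj₂ x≤d = x≤d

  χ-meet : ∀ {x y} → χ x ≡ true → χ y ≡ true → χ (x ∧ y) ≡ true
  χ-meet {x} {y} p q with section x | section y
  ... | u , refl | v , refl = trans (cong χ (sym (preserves π ∧ˢ (lookup (u ∷ v ∷ [])))))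
    (χ-up (∧-glb (χ-true p) (χ-true q)))

  χ-join : ∀ {x y} → χ x ≡ false → χ y ≡ false → χ (x ∨ y) ≡ false
  χ-join {x} {y} p q with section x | section y
  ... | u , refl | v , refl = trans (cong χ (sym (preserves π ∨ˢ (lookup (u ∷ v ∷ [])))))
    (χ-down (∨-lub (χ-false p) (χ-false q)))

  χ-upward : ∀ {x y} → x ≡ x ∧ y → χ x ≡ true → χ y ≡ true
  χ-upward {x} {y} x≡x∧y p with section x | section y
  ... | u , refl | v , refl = χ-up (≤ₜ-trans
    (χ-true (trans (cong χ (trans (preserves π ∧ˢ (lookup (u ∷ v ∷ []))) (sym x≡x∧y))) p))
    (∧-lower₂ u v))

  eval-name-M : (ρ : Fin k → J ℓ m) (x : J ℓ n) → eval M ρ (name x) ≡ to π x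
  eval-name-M ρ x = trans (eval-constant M ρ x) (trans (sym (eval-constant M (const (to π x)) x))
    (trans (sym (hom-eval π {m = 1} (const x) (name x))) (cong (to π) (eval-name _ x))))

  determined : ∀ {x y} → (∀ j → χ (eval M (const x) (readings j)) ≡ χ (eval M (const y) (readings j))) → x ≡ y
  determined {x} {y} eq = trans (sym (decode-readings x))
    (trans (cong decode (tabulate-cong eq)) (decode-readings y))

module Classical (em : ∀ {a} → ExcludedMiddle a)
  {ℓ : Level} {n q : ℕ} {σ : Fin (suc n) → Fin (suc q)} (𝔖 : Separator ℓ n q σ) where
  open Separator 𝔖

  module FilterHom (A : Algebra (sig n) ℓ) (sat : Satisfies (𝐉 n) A)
    (U : PrimeFilters.PrimeFilter (truthLattice A sat)) where

    open PrimeFilters (truthLattice A sat)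
    open PrimeFilter U
    open Setoid (domain A) using (_≈_) renaming (sym to ≈-sym; trans to ≈-trans)

    member-cong : ∀ {x y} → x ≈ y → member x ≡ member y
    member-cong p = ⇔→≡ (mk⇔ (upward (reflexive p)) (upward (reflexive (≈-sym p))))

    reading : Carrier A → Vec Bool (suc r)
    reading x = tabulate λ j → member (eval A (const x) (readings j))

    module _ (c∈ : member (constant A c) ≡ true) (d∉ : member (constant A d) ≡ false) where

      -- α is the meet of the `τ i` lying in the filter, started from `c`. The bound α ≤ c serves to
      -- refute that some `τ i` outside the filter takes a value above c: then α ≤ c ≤ `τ i` ≤ β.
      -- The dual bound d ≤ β of `upper-bound` settles the other mismatch.
      lower-bound : (τ : Fin k → Term (sig n) m) (ρ : Fin m → Carrier A) →
        ∃ λ α → member (eval A ρ α) ≡ true × ∀ ρ′ →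
          eval (𝐉 n) ρ′ α ≤ₜ c ×
          (∀ i → member (eval A ρ (τ i)) ≡ true → eval (𝐉 n) ρ′ α ≤ₜ eval (𝐉 n) ρ′ (τ i))
      lower-bound {zero}  τ ρ = name c , trans (cong member (eval-constant A ρ c)) c∈ ,
        λ ρ′ → ≤ₜ-reflexive (eval-name ρ′ c) , λ ()
      lower-bound {suc k} τ ρ with member (eval A ρ (τ zero)) in eq | lower-bound (τ ∘ suc) ρ
      ... | false | α , α∈ , α≤ = α , α∈ , λ ρ′ → proj₁ (α≤ ρ′) , λ where
        zero    τ₀∈ → contradiction (trans (sym eq) τ₀∈) λ ()
        (suc i) → proj₂ (α≤ ρ′) i
      ... | true  | α , α∈ , α≤ = τ zero ∧ᵗ α , meet eq α∈ , λ ρ′ →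
        ≤ₜ-trans (∧-lower₂ _ _) (proj₁ (α≤ ρ′)) , λ where
          zero    _   → ∧-lower₁ _ _
          (suc i) τᵢ∈ → ≤ₜ-trans (∧-lower₂ _ _) (proj₂ (α≤ ρ′) i τᵢ∈)

      upper-bound : (τ : Fin k → Term (sig n) m) (ρ : Fin m → Carrier A) →
        ∃ λ β → member (eval A ρ β) ≡ false × ∀ ρ′ →
          d ≤ₜ eval (𝐉 n) ρ′ β ×
          (∀ i → member (eval A ρ (τ i)) ≡ false → eval (𝐉 n) ρ′ (τ i) ≤ₜ eval (𝐉 n) ρ′ β)
      upper-bound {zero}  τ ρ = name d , trans (cong member (eval-constant A ρ d)) d∉ ,
        λ ρ′ → ≤ₜ-reflexive (sym (eval-name ρ′ d)) , λ ()
      upper-bound {suc k} τ ρ with member (eval A ρ (τ zero)) in eq | upper-bound (τ ∘ suc) ρ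
      ... | true  | β , β∉ , ≤β = β , β∉ , λ ρ′ → proj₁ (≤β ρ′) , λ where
        zero    τ₀∉ → contradiction (trans (sym eq) τ₀∉) λ ()
        (suc i) → proj₂ (≤β ρ′) i
      ... | false | β , β∉ , ≤β = τ zero ∨ᵗ β , prime eq β∉ , λ ρ′ →
        ≤ₜ-trans (proj₁ (≤β ρ′)) (∨-upper₂ _ _) , λ where
          zero    _   → ∨-upper₁ _ _
          (suc i) τᵢ∉ → ≤ₜ-trans (proj₂ (≤β ρ′) i τᵢ∉) (∨-upper₂ _ _)

      -- With α a meet of terms whose values lie in the filter and β a join of
      -- terms whose values do not, α ≤ β fails in A, hence at some point of J.
      realize : (τ : Fin k → Term (sig n) m) (ρ : Fin m → Carrier A) →
        ∃ λ ρ′ → ∀ i → member (eval A ρ (τ i)) ≡ χ (to π (eval (𝐉 n) ρ′ (τ i)))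
      realize τ ρ with lower-bound τ ρ | upper-bound τ ρ
      ... | α , α∈ , α≤ | β , β∉ , ≤β with em {P = ∃ λ ρ′ → ¬ (eval (𝐉 n) ρ′ α ≤ₜ eval (𝐉 n) ρ′ β)}
      ...   | no none = contradiction
              (trans (sym (upward (satisfies-≤ A sat α β (λ ρ′ → decidable-stable em λ ¬le → none (ρ′ , ¬le)) ρ) α∈)) β∉) λ ()
      ...   | yes (ρ′ , α≰β) = ρ′ , agree
        where
        agree : ∀ i → member (eval A ρ (τ i)) ≡ χ (to π (eval (𝐉 n) ρ′ (τ i)))
        agree i with member (eval A ρ (τ i)) in eq | split (eval (𝐉 n) ρ′ (τ i))
        ... | true  | inj₁ c≤ = sym (χ-up c≤)
        ... | true  | inj₂ ≤d = contradiction
          (≤ₜ-trans (proj₂ (α≤ ρ′) i eq) (≤ₜ-trans ≤d (proj₁ (≤β ρ′)))) α≰β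
        ... | false | inj₁ c≤ = contradiction
          (≤ₜ-trans (proj₁ (α≤ ρ′)) (≤ₜ-trans c≤ (proj₂ (≤β ρ′) i eq))) α≰β
        ... | false | inj₂ ≤d = sym (χ-down ≤d)

      -- A single assignment has to serve every reading of every `s i`, so the whole two-dimensional
      -- array of terms is flattened by `combine` and realized at once.
      realize-readings : (s : Fin k → Term (sig n) m) (ρ : Fin m → Carrier A) →
        ∃ λ ρ′ → ∀ i j → member (eval A (const (eval A ρ (s i))) (readings j)) ≡
                         χ (eval M (const (to π (eval (𝐉 n) ρ′ (s i)))) (readings j))
      realize-readings {k} s ρ = ρ′ , λ i j →
        trans (sym (member-cong (eval-[] A ρ (readings j) (const (s i)))))
          (trans (subst (λ p → member (eval A ρ (at p)) ≡ χ (to π (eval (𝐉 n) ρ′ (at p))))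
                        (Fin.remQuot-combine i j) (eq (combine i j)))
            (cong χ (trans (cong (to π) (eval-[] (𝐉 n) ρ′ (readings j) (const (s i))))
                           (hom-eval π _ (readings j)))))
        where
        at : Fin k × Fin (suc r) → Term (sig n) _
        at (i , j) = readings j [ const (s i) ]
        realized = realize (at ∘ remQuot {k} (suc r)) ρ
        ρ′ = proj₁ realized
        eq = proj₂ realized

      realize-decode : (s : Fin k → Term (sig n) m) (ρ : Fin m → Carrier A) →
        ∃ λ ρ′ → ∀ i → decode (reading (eval A ρ (s i))) ≡ to π (eval (𝐉 n) ρ′ (s i))
      realize-decode s ρ with realize-readings s ρ
      ... | ρ′ , eq = ρ′ , λ i → trans (cong decode (tabulate-cong (eq i))) (decode-readings _)

      filterHom : Hom A M
      filterHom = record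
        { func = record
          { to   = decode ∘ reading
          ; cong = λ p → cong decode (tabulate-cong λ j → member-cong (eval-cong A (const p) (readings j)))
          }
        ; preserves = pres
        }
        where
        pres : ∀ o xs → decode (reading (op A o xs)) ≡ op M o (decode ∘ reading ∘ xs)
        -- The operation and its arguments are realized by the same assignment ρ′, so the claim
        -- reduces to preservation of `o` by `π` at ρ′.
        pres o xs with realize-decode (λ { zero → app o (tabulate var) ; (suc i) → var i }) xs
        ... | ρ′ , eq =
          trans (cong decode (tabulate-cong λ j → member-cong (eval-cong A
                  (λ _ → op-cong A o λ i → ≈-sym (evals-tabulate A xs var i)) (readings j))))
            (trans (eq zero)
              (trans (cong (to π) (op-cong (𝐉 n) o (evals-tabulate (𝐉 n) ρ′ var)))
                (trans (preserves π o ρ′) (op-cong M o λ i → sym (eq (suc i))))))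

      member-filterHom : ∀ x → member x ≡ χ (to filterHom x)
      member-filterHom x with realize-readings {k = 1} {m = 1} var (const x)
      ... | ρ′ , eq = trans (eq 0F 0F)
        (cong χ (sym (trans (cong decode (tabulate-cong (eq 0F))) (decode-readings _))))

  module _ (zorn : ∀ {a ℓ₁ ℓ₂ c} → ZornsLemma a ℓ₁ ℓ₂ c) where

    -- Pulling `χ` back along `h` gives a prime filter of A. It and its complement generate in B a
    -- filter and an ideal that are disjoint. A prime filter of B between them decodes to a
    -- homomorphism, and on the image of A its readings are those of `h`.
    extend : (A B : Algebra (sig n) ℓ) → Satisfies (𝐉 n) A → Satisfies (𝐉 n) B →
      (e : A ↪ B) (h : Hom A M) → Σ[ g ∈ Hom B M ] (∀ a → to g (to (proj₁ e) a) ≡ to h a)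
    extend A B satA satB (e , e-inj) h = filterHom c∈ d∉ , agree
      where
      open DistributiveLattice (truthLattice A satA) using ()
        renaming (_∧_ to _⊓ᴬ_; _∨_ to _⊔ᴬ_)
      open DistributiveLattice (truthLattice B satB) hiding (Carrier)
        renaming (_∧_ to _⊓_; _∨_ to _⊔_; _≤_ to _⊑_; trans to ⊑-trans)
      open Setoid (domain B) using () renaming (sym to ≈-sym; trans to ≈-trans)

      e-meet : ∀ x y → to e (x ⊓ᴬ y) ≈ to e x ⊓ to e y
      e-meet x y = hom-eval e (lookup (x ∷ y ∷ [])) (var 0F ∧ᵗ var 1F)

      e-join : ∀ x y → to e (x ⊔ᴬ y) ≈ to e x ⊔ to e y
      e-join x y = hom-eval e (lookup (x ∷ y ∷ [])) (var 0F ∨ᵗ var 1F)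

      h-meet : ∀ x y → to h (x ⊓ᴬ y) ≡ to h x ∧ to h y
      h-meet x y = hom-eval h (lookup (x ∷ y ∷ [])) (var 0F ∧ᵗ var 1F)

      h-join : ∀ x y → to h (x ⊔ᴬ y) ≡ to h x ∨ to h y
      h-join x y = hom-eval h (lookup (x ∷ y ∷ [])) (var 0F ∨ᵗ var 1F)

      -- Closing upwards and downwards suffices: the images of the two parts of A are already closed
      -- under meets and joins respectively.
      F I : Pred (Carrier B) ℓ
      F b = ∃ λ a → χ (to h a) ≡ true × to e a ⊑ b
      I b = ∃ λ a → χ (to h a) ≡ false × b ⊑ to e a

      h-constant : ∀ x → to h (constant A x) ≡ to π x
      h-constant x = trans (hom-eval h _ (name x)) (eval-name-M _ x)

      e-constant : ∀ x → to e (constant A x) ≈ constant B x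
      e-constant x = ≈-trans (hom-eval e _ (name x)) (Setoid.reflexive (domain B) (eval-constant B _ x))

      disjoint : ∀ {b} → F b → ¬ I b
      disjoint (a , a∈ , ea⊑b) (a′ , a′∉ , b⊑ea′) = contradiction
        (trans (sym (χ-upward (trans (Hom.cong h a⊑a′) (h-meet a a′)) a∈)) a′∉) λ ()
        -- An embedding reflects the order, because the order is an equation.
        where a⊑a′ = e-inj (≈-trans (⊑-trans ea⊑b b⊑ea′) (≈-sym (e-meet a a′)))

      extension = PrimeFilterTheorem.primeFilter em zorn (truthLattice B satB) F I
        (to e (constant A c) , constant A c , trans (cong χ (h-constant c)) (χ-up ≤ₜ-refl) , reflexive (Setoid.refl (domain B)))
        (λ { (a , a∈ , ea⊑b) (a′ , a′∈ , ea′⊑b′) → a ⊓ᴬ a′ , trans (cong χ (h-meet a a′)) (χ-meet a∈ a′∈) ,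
             ⊑-trans (reflexive (e-meet a a′))
               (∧-greatest (⊑-trans (x∧y≤x _ _) ea⊑b) (⊑-trans (x∧y≤y _ _) ea′⊑b′)) })
        (λ { b⊑b′ (a , a∈ , ea⊑b) → a , a∈ , ⊑-trans ea⊑b b⊑b′ })
        (λ { (a , a∉ , b⊑ea) (a′ , a′∉ , b′⊑ea′) → a ⊔ᴬ a′ , trans (cong χ (h-join a a′)) (χ-join a∉ a′∉) ,
             ⊑-trans (∨-least (⊑-trans b⊑ea (x≤x∨y _ _)) (⊑-trans b′⊑ea′ (y≤x∨y _ _)))
               (reflexive (≈-sym (e-join a a′))) })
        (λ { b⊑b′ (a , a∉ , b′⊑ea) → a , a∉ , ⊑-trans b⊑b′ b′⊑ea })
        disjoint

      open FilterHom B satB (proj₁ extension)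
      open PrimeFilters.PrimeFilter (proj₁ extension) using (member)

      member-e : ∀ a → member (to e a) ≡ χ (to h a)
      member-e a with χ (to h a) in eq
      ... | true  = proj₁ (proj₂ extension) (a , eq , reflexive (Setoid.refl (domain B)))
      ... | false = proj₂ (proj₂ extension) (a , eq , reflexive (Setoid.refl (domain B)))

      member-constant : ∀ x → member (constant B x) ≡ χ (to π x)
      member-constant x = trans (sym (member-cong (e-constant x)))
        (trans (member-e (constant A x)) (cong χ (h-constant x)))

      c∈ : member (constant B c) ≡ true
      c∈ = trans (member-constant c) (χ-up ≤ₜ-refl)

      d∉ : member (constant B d) ≡ false
      d∉ = trans (member-constant d) (χ-down ≤ₜ-refl)

      agree : ∀ a → decode (reading (to e a)) ≡ to h a
      agree a = trans (cong decode (tabulate-cong λ j →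
          trans (sym (member-cong (hom-eval e (const a) (readings j))))
            (trans (member-e _) (cong χ (hom-eval h (const a) (readings j))))))
        (decode-readings (to h a))

  -- The images of c and `c ∧ d` generate the monolith: some coordinate of an embedding keeps them
  -- apart, and that coordinate is then injective.
  subdirectlyIrreducible : SubdirectlyIrreducible M
  subdirectlyIrreducible = (to π c , to π (c ∧ d) , c≢c∧d) , irreducible
    where
    χ-c : χ (to π c) ≡ true
    χ-c = χ-up ≤ₜ-refl

    c≢c∧d : ¬ (to π c ≡ to π (c ∧ d))
    c≢c∧d eq = contradiction (trans (sym χ-c) (trans (cong χ eq) (χ-down (∧-lower₂ c d)))) λ ()

    -- c ∧ (d ∨ x) takes the value c if c ≤ x, and c ∧ d if x ≤ d, so every
    -- nontrivial congruence of M identifies c with c ∧ d.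
    μ : Term (sig n) 1 → Term (sig n) 1
    μ s = name c ∧ᵗ (name d ∨ᵗ s)

    eval-μ : ∀ x s → eval M (const x) (μ s) ≡ (if χ (eval M (const x) s) then to π c else to π (c ∧ d))
    eval-μ x s with eval M (const x) s | section (eval M (const x) s)
    ... | _ | u , refl = trans
      (cong₂ (λ p q → p ∧ (q ∨ to π u)) (eval-name-M (const x) c) (eval-name-M (const x) d))
      (trans (sym c∧[d∨u]) (eval-c∧[d∨u] (split u)))
      where
      c∧[d∨u] : to π (c ∧ (d ∨ u)) ≡ to π c ∧ (to π d ∨ to π u)
      c∧[d∨u] = trans (preserves π ∧ˢ (lookup (c ∷ d ∨ u ∷ [])))
        (cong (to π c ∧_) (preserves π ∨ˢ (lookup (d ∷ u ∷ []))))
      eval-c∧[d∨u] : c ≤ₜ u ⊎ u ≤ₜ d →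
        to π (c ∧ (d ∨ u)) ≡ (if χ (to π u) then to π c else to π (c ∧ d))
      eval-c∧[d∨u] (inj₁ c≤u) rewrite χ-up c≤u = cong (to π)
        (≤ₜ-antisym (∧-lower₁ _ _) (∧-glb ≤ₜ-refl (≤ₜ-trans c≤u (∨-upper₂ d u))))
      eval-c∧[d∨u] (inj₂ u≤d) rewrite χ-down u≤d = cong (to π ∘ (c ∧_))
        (≤ₜ-antisym (∨-lub ≤ₜ-refl u≤d) (∨-upper₁ d u))

    irreducible : (I : Set ℓ) (𝒜 : I → Algebra (sig n) ℓ) (α : Hom M (Π I 𝒜)) →
      IsEmbedding α →
      (∀ i → Surjective _≡_ (Algebra._≈_ (𝒜 i)) (λ a → to α a i)) →
      ∃ λ i → Bijective _≡_ (Algebra._≈_ (𝒜 i)) (λ a → to α a i)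
    irreducible I 𝒜 α α-inj α-surj with em {P = ∃ λ i → ¬ (Algebra._≈_ (𝒜 i) (to α (to π c) i) (to α (to π (c ∧ d)) i))}
    ... | no none = contradiction (α-inj λ i → decidable-stable em λ ¬eq → none (i , ¬eq)) c≢c∧d
    -- Elements identified by this coordinate agree under `χ` at every term, in particular at the
    -- readings, which determine them.
    ... | yes (i , c≉c∧d) = i , (λ {x} {y} eq → determined λ j → same eq (readings j)) , α-surj i
      where
      αᵢ = projection 𝒜 i ∘ʰ α
      open Setoid (domain (𝒜 i)) using (_≈_) renaming (sym to ≈-sym; trans to ≈-trans; reflexive to ≈-reflexive)

      αᵢ-eval : ∀ {x y} → to αᵢ x ≈ to αᵢ y → ∀ s → to αᵢ (eval M (const x) s) ≈ to αᵢ (eval M (const y) s)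
      αᵢ-eval eq s = ≈-trans (hom-eval αᵢ _ s) (≈-trans (eval-cong (𝒜 i) (const eq) s) (≈-sym (hom-eval αᵢ _ s)))

      same : ∀ {x y} → to αᵢ x ≈ to αᵢ y → ∀ s → χ (eval M (const x) s) ≡ χ (eval M (const y) s)
      same {x} {y} eq s with χ (eval M (const x) s) | χ (eval M (const y) s) | eval-μ x s | eval-μ y s
      ... | true  | true  | _ | _ = refl
      ... | false | false | _ | _ = refl
      ... | true  | false | p | q = contradiction
        (≈-trans (≈-reflexive (cong (to αᵢ) (sym p))) (≈-trans (αᵢ-eval eq (μ s)) (≈-reflexive (cong (to αᵢ) q)))) c≉c∧d
      ... | false | true  | p | q = contradiction
        (≈-trans (≈-reflexive (cong (to αᵢ) (sym q))) (≈-trans (≈-sym (αᵢ-eval eq (μ s))) (≈-reflexive (cong (to αᵢ) p)))) c≉c∧d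

-- The algebras 𝐉₀ n and 𝐉₁ n k as quotients of 𝐉 n

module _ {ℓ : Level} {p q : ℕ} (ρ : Fin (suc p) → Fin (suc q)) where

  mapJ : J ℓ p → J ℓ q
  mapJ ⊤     = ⊤
  mapJ ⊥     = ⊥
  mapJ (f i) = f (ρ i)
  mapJ (t i) = t (ρ i)

  module _ (mono : ∀ {i j} → i ≤ᶠ j → ρ i ≤ᶠ ρ j) (ρ-last : ρ (fromℕ p) ≡ fromℕ q) where

    private
      module Mx {r : ℕ} = Max (Fin.≤-totalOrder (suc r))
      module Mn {r : ℕ} = Min (Fin.≤-totalOrder (suc r))

    map-max : ∀ i j → ρ (max i j) ≡ max (ρ i) (ρ j)
    map-max i j = [
      (λ i≤j → trans (cong ρ (Mx.x≤y⇒x⊔y≈y i≤j)) (sym (Mx.x≤y⇒x⊔y≈y (mono i≤j)))) ,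
      (λ j≤i → trans (cong ρ (Mx.x≤y⇒y⊔x≈y j≤i)) (sym (Mx.x≤y⇒y⊔x≈y (mono j≤i)))) ]′ (Fin.≤-total i j)

    map-min : ∀ i j → ρ (min i j) ≡ min (ρ i) (ρ j)
    map-min i j = [
      (λ i≤j → trans (cong ρ (Mn.x≤y⇒x⊓y≈x i≤j)) (sym (Mn.x≤y⇒x⊓y≈x (mono i≤j)))) ,
      (λ j≤i → trans (cong ρ (Mn.x≤y⇒y⊓x≈x j≤i)) (sym (Mn.x≤y⇒y⊓x≈x (mono j≤i)))) ]′ (Fin.≤-total i j)

    map-⊗ : ∀ x y → mapJ (x ⊗ y) ≡ mapJ x ⊗ mapJ y
    map-⊗ ⊤     y     = refl
    map-⊗ ⊥     y     = refl
    map-⊗ (f i) ⊤     = refl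
    map-⊗ (f i) ⊥     = refl
    map-⊗ (f i) (f j) = cong f (map-max i j)
    map-⊗ (f i) (t j) = refl
    map-⊗ (t i) ⊤     = refl
    map-⊗ (t i) ⊥     = refl
    map-⊗ (t i) (f j) = refl
    map-⊗ (t i) (t j) = cong t (map-max i j)

    map-⊕ : ∀ x y → mapJ (x ⊕ y) ≡ mapJ x ⊕ mapJ y
    map-⊕ ⊤     y     = refl
    map-⊕ ⊥     y     = refl
    map-⊕ (f i) ⊤     = refl
    map-⊕ (f i) ⊥     = refl
    map-⊕ (f i) (f j) = cong f (map-min i j)
    map-⊕ (f i) (t j) = refl
    map-⊕ (t i) ⊤     = refl
    map-⊕ (t i) ⊥     = refl
    map-⊕ (t i) (f j) = refl
    map-⊕ (t i) (t j) = cong t (map-min i j)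

    map-∧ : ∀ x y → mapJ (x ∧ y) ≡ mapJ x ∧ mapJ y
    map-∧ ⊤     ⊤     = refl
    map-∧ ⊤     ⊥     = cong f ρ-last
    map-∧ ⊤     (f j) = refl
    map-∧ ⊤     (t j) = refl
    map-∧ ⊥     ⊤     = cong f ρ-last
    map-∧ ⊥     ⊥     = refl
    map-∧ ⊥     (f j) = refl
    map-∧ ⊥     (t j) = refl
    map-∧ (f i) ⊤     = refl
    map-∧ (f i) ⊥     = refl
    map-∧ (f i) (f j) = cong f (map-min i j)
    map-∧ (f i) (t j) = refl
    map-∧ (t i) ⊤     = refl
    map-∧ (t i) ⊥     = refl
    map-∧ (t i) (f j) = refl
    map-∧ (t i) (t j) = cong t (map-max i j)

    map-∨ : ∀ x y → mapJ (x ∨ y) ≡ mapJ x ∨ mapJ y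
    map-∨ ⊤     ⊤     = refl
    map-∨ ⊤     ⊥     = cong t ρ-last
    map-∨ ⊤     (f j) = refl
    map-∨ ⊤     (t j) = refl
    map-∨ ⊥     ⊤     = cong t ρ-last
    map-∨ ⊥     ⊥     = refl
    map-∨ ⊥     (f j) = refl
    map-∨ ⊥     (t j) = refl
    map-∨ (f i) ⊤     = refl
    map-∨ (f i) ⊥     = refl
    map-∨ (f i) (f j) = cong f (map-max i j)
    map-∨ (f i) (t j) = refl
    map-∨ (t i) ⊤     = refl
    map-∨ (t i) ⊥     = refl
    map-∨ (t i) (f j) = refl
    map-∨ (t i) (t j) = cong t (map-min i j)

    map-neg : ∀ x → mapJ (neg x) ≡ neg (mapJ x)
    map-neg ⊤     = refl
    map-neg ⊥     = refl
    map-neg (f i) = refl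
    map-neg (t i) = refl

    -- Monotonicity makes ρ commute with `max` and `min`. The last index must be preserved because
    -- `⊤ ∧ ⊥` and `⊤ ∨ ⊥` are the elements carrying it.
    mapHom : ∀ {n} {σ : Fin (suc n) → Fin (suc p)} {τ : Fin (suc n) → Fin (suc q)} →
      (∀ i → ρ (σ i) ≡ τ i) → Hom (reindexed n p σ) (reindexed n q τ)
    mapHom ρσ≡τ = record
      { func = record { to = mapJ ; cong = cong mapJ }
      ; preserves = λ where
          ⊗ˢ     xs → map-⊗ (xs 0F) (xs 1F)
          ⊕ˢ     xs → map-⊕ (xs 0F) (xs 1F)
          ∧ˢ     xs → map-∧ (xs 0F) (xs 1F)
          ∨ˢ     xs → map-∨ (xs 0F) (xs 1F)
          ¬ˢ     xs → map-neg (xs 0F)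
          ⊤ˢ     xs → refl
          ⊥ˢ     xs → refl
          (fˢ i) xs → cong f (ρσ≡τ i)
          (tˢ i) xs → cong t (ρσ≡τ i)
      }

-- Separators for the four kinds of prime pairs.

Fin1-unique : (i j : Fin 1) → i ≡ j
Fin1-unique 0F 0F = refl

module _ {ℓ : Level} {n : ℕ} (σ : Fin (suc n) → Fin 1) where

  private
    π₀ : Hom (𝐉 n) (reindexed {ℓ} n 0 σ)
    π₀ = mapHom σ (λ {i} {j} _ → Fin.≤-reflexive (Fin1-unique (σ i) (σ j))) (Fin1-unique _ _) (λ _ → refl)

    section₀ : ∀ y → ∃ λ x → to π₀ x ≡ y
    section₀ ⊤      = ⊤ , refl
    section₀ ⊥      = ⊥ , refl
    section₀ (f 0F) = f zero , cong f (Fin1-unique _ _)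
    section₀ (t 0F) = t zero , cong t (Fin1-unique _ _)

  -- Arbitrary `σ` covers both `𝐉₀ n`, with index map `const zero`, and `𝐉 0`, with index map `id`.
  -- Membership of an element and of its negation already tells all four elements apart.
  separator-⊤⊥ : Separator ℓ n 0 σ
  separator-⊤⊥ = record
    { π = π₀
    ; section = section₀
    ; c = ⊤
    ; d = ⊥
    ; split = λ where
        ⊤     → inj₁ ⊤≤⊤
        ⊥     → inj₂ ⊥≤⊥
        (f _) → inj₂ f≤⊥
        (t _) → inj₁ ⊤≤t
    ; χ = λ where
        ⊤     → true
        ⊥     → false
        (f _) → false
        (t _) → true
    ; χ-up = λ { ⊤≤⊤ → refl ; ⊤≤t → refl }
    ; χ-down = λ { ⊥≤⊥ → refl ; f≤⊥ → refl }
    ; extra = negᵗ (var 0F) ∷ []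
    ; decode = λ where
        (true  ∷ true  ∷ []) → ⊤
        (true  ∷ false ∷ []) → t 0F
        (false ∷ true  ∷ []) → f 0F
        (false ∷ false ∷ []) → ⊥
    ; decode-readings = λ { ⊤ → refl ; ⊥ → refl ; (f 0F) → refl ; (t 0F) → refl }
    }

  separator-⊥⊤ : Separator ℓ n 0 σ
  separator-⊥⊤ = record
    { π = π₀
    ; section = section₀
    ; c = ⊥
    ; d = ⊤
    ; split = λ where
        ⊤     → inj₂ ⊤≤⊤
        ⊥     → inj₁ ⊥≤⊥
        (f _) → inj₂ f≤⊤
        (t _) → inj₁ ⊥≤t
    ; χ = λ where
        ⊤     → false
        ⊥     → true
        (f _) → false
        (t _) → true
    ; χ-up = λ { ⊥≤⊥ → refl ; ⊥≤t → refl }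
    ; χ-down = λ { ⊤≤⊤ → refl ; f≤⊤ → refl }
    ; extra = negᵗ (var 0F) ∷ []
    ; decode = λ where
        (true  ∷ true  ∷ []) → ⊥
        (true  ∷ false ∷ []) → t 0F
        (false ∷ true  ∷ []) → f 0F
        (false ∷ false ∷ []) → ⊤
    ; decode-readings = λ { ⊤ → refl ; ⊥ → refl ; (f 0F) → refl ; (t 0F) → refl }
    }

-- Names the index map of `𝐉₁`, so that `𝐉₁ n k` is definitionally `reindexed n 1 (threshold k)`.
threshold : ℕ → Fin m → Fin 2
threshold k i = if toℕ i <ᵇ k then 0F else 1F

threshold-< : ∀ {k} {i : Fin m} → toℕ i < k → threshold k i ≡ 0F
threshold-< {k = k} {i} i<k with toℕ i <ᵇ k | ℕ.<⇒<ᵇ i<k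
... | true | _ = refl

threshold-≥ : ∀ {k} {i : Fin m} → k ℕ.≤ toℕ i → threshold k i ≡ 1F
threshold-≥ {k = k} {i} k≤i with toℕ i <ᵇ k in eq
... | false = refl
... | true  = contradiction (ℕ.<ᵇ⇒< (toℕ i) k (subst T (sym eq) _)) (ℕ.≤⇒≯ k≤i)

threshold-mono : ∀ k {i j : Fin m} → i ≤ᶠ j → threshold k i ≤ᶠ threshold k j
threshold-mono k {i} {j} i≤j with toℕ i <ᵇ k in eq | ℕ.<-≤-connex (toℕ i) k
... | true  | _ = z≤n
... | false | inj₁ i<k = contradiction (subst T eq (ℕ.<⇒<ᵇ i<k)) id
... | false | inj₂ k≤i = Fin.≤-reflexive (sym (threshold-≥ {i = j} (ℕ.≤-trans k≤i i≤j)))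

module _ {ℓ : Level} {n : ℕ} (j : Fin n) where

  private
    -- Here k is `suc (toℕ j)`, so that `inject₁ j` and `suc j` are the indices k - 1 and k on the
    -- two sides of the threshold.
    σ : Fin (suc n) → Fin 2
    σ = threshold (suc (toℕ j))

    σ-low : ∀ {i} → i ≤ᶠ inject₁ j → σ i ≡ 0F
    σ-low {i} i≤j = threshold-< {i = i} (s≤s (subst (toℕ i ℕ.≤_) (Fin.toℕ-inject₁ j) i≤j))

    σ-high : ∀ {i} → suc j ≤ᶠ i → σ i ≡ 1F
    σ-high {i} = threshold-≥ {i = i}

    low-or-high : (i : Fin (suc n)) → i ≤ᶠ inject₁ j ⊎ suc j ≤ᶠ i
    low-or-high i with ℕ.≤-<-connex (toℕ i) (toℕ j)
    ... | inj₁ i≤j = inj₁ (subst (toℕ i ℕ.≤_) (sym (Fin.toℕ-inject₁ j)) i≤j)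
    ... | inj₂ j<i = inj₂ j<i

    π₁ : Hom (𝐉 n) (𝐉₁ {ℓ} n (suc (toℕ j)))
    π₁ = mapHom σ (threshold-mono (suc (toℕ j))) (σ-high {fromℕ n} (Fin.≤fromℕ (suc j))) (λ _ → refl)

    section₁ : ∀ y → ∃ λ x → to π₁ x ≡ y
    section₁ ⊤      = ⊤ , refl
    section₁ ⊥      = ⊥ , refl
    section₁ (f 0F) = f zero , refl
    section₁ (f 1F) = f (fromℕ n) , cong f (σ-high {fromℕ n} (Fin.≤fromℕ (suc j)))
    section₁ (t 0F) = t zero , refl
    section₁ (t 1F) = t (fromℕ n) , cong t (σ-high {fromℕ n} (Fin.≤fromℕ (suc j)))

    -- φ maps t, 𝟏 and ⊤ to 𝟏, and the other elements to ⊥.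
    φ : Term (sig n) 1 → Term (sig n) 1
    φ s = s ∧ᵗ name {ℓ} ⊤ ⊗ᵗ name {ℓ} (t zero)

    x : Term (sig n) 1
    x = var 0F

    is-𝟏 not-𝟎 : J ℓ 1 → Bool
    is-𝟏 (t 0F)  = true
    is-𝟏 _       = false
    not-𝟎 (f 0F) = false
    not-𝟎 _      = true

  separator-t : Separator ℓ n 1 σ
  separator-t = record
    { π = π₁
    ; section = section₁
    ; c = t (inject₁ j)
    ; d = t (suc j)
    ; split = λ where
        ⊤     → inj₂ ⊤≤t
        ⊥     → inj₂ ⊥≤t
        (f _) → inj₂ f≤t
        (t i) → Sum.map t≤t t≤t (low-or-high i)
    ; χ = is-𝟏
    ; χ-up = λ { (t≤t i≤j) → cong (is-𝟏 ∘ t) (σ-low i≤j) }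
    ; χ-down = λ where
        ⊤≤t       → refl
        ⊥≤t       → refl
        f≤t       → refl
        (t≤t j<i) → cong (is-𝟏 ∘ t) (σ-high j<i)
    -- `is-𝟏` at x and its negation isolates only 𝟏 and 𝟎. After `φ` it becomes the indicator of the
    -- elements above ⊤, which separates the other four as in `𝐉₀`.
    ; extra = negᵗ x ∷ φ x ∷ φ (negᵗ x) ∷ []
    ; decode = λ where
        (true  ∷ _) → t 0F
        (false ∷ true ∷ _) → f 0F
        (false ∷ false ∷ true  ∷ true  ∷ []) → ⊤
        (false ∷ false ∷ true  ∷ false ∷ []) → t 1F
        (false ∷ false ∷ false ∷ true  ∷ []) → f 1F
        (false ∷ false ∷ false ∷ false ∷ []) → ⊥
    ; decode-readings = λ where
        ⊤      → refl
        ⊥      → refl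
        (f 0F) → refl
        (f 1F) → refl
        (t 0F) → refl
        (t 1F) → refl
    }

  separator-f : Separator ℓ n 1 σ
  separator-f = record
    { π = π₁
    ; section = section₁
    ; c = f (suc j)
    ; d = f (inject₁ j)
    ; split = λ where
        ⊤     → inj₁ f≤⊤
        ⊥     → inj₁ f≤⊥
        (t _) → inj₁ f≤t
        (f i) → Sum.map f≤f f≤f (swap (low-or-high i))
    ; χ = not-𝟎
    ; χ-up = λ where
        f≤⊤       → refl
        f≤⊥       → refl
        f≤t       → refl
        (f≤f j<i) → cong (not-𝟎 ∘ f) (σ-high j<i)
    ; χ-down = λ { (f≤f i≤j) → cong (not-𝟎 ∘ f) (σ-low i≤j) }
    -- `not-𝟎` does not distinguish the values 𝟏 and ⊥ of `φ`, but it does distinguish their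
    -- negations 𝟎 and ⊥.
    ; extra = negᵗ x ∷ negᵗ (φ x) ∷ negᵗ (φ (negᵗ x)) ∷ []
    ; decode = λ where
        (false ∷ _) → f 0F
        (true  ∷ false ∷ _) → t 0F
        (true  ∷ true  ∷ false ∷ false ∷ []) → ⊤
        (true  ∷ true  ∷ false ∷ true  ∷ []) → t 1F
        (true  ∷ true  ∷ true  ∷ false ∷ []) → f 1F
        (true  ∷ true  ∷ true  ∷ true  ∷ []) → ⊥
    ; decode-readings = λ where
        ⊤      → refl
        ⊥      → refl
        (f 0F) → refl
        (f 1F) → refl
        (t 0F) → refl
        (t 1F) → refl
    }

-- The subdirectly irreducible algebras and the separation theorem

size : Fin (suc n) → ℕ
size zero    = 0
size (suc _) = 1

index : (s : Fin (suc n)) → Fin (suc n) → Fin (suc (size s))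
index zero    = const zero
index (suc j) = threshold (suc (toℕ j))

-- A single indexing of all n + 1 algebras: `zero` stands for `𝐉₀ n` and `suc j` for
-- `𝐉₁ n (suc (toℕ j))`, both definitionally.
𝐈 : (s : Fin (suc n)) → Algebra (sig n) ℓ
𝐈 {n} s = reindexed n (size s) (index s)

-- Either prime pair of an algebra yields extension and irreducibility; separation uses both.
separator : (s : Fin (suc n)) → Separator ℓ n (size s) (index s)
separator zero    = separator-⊤⊥ _
separator (suc j) = separator-t j

-- A discrete intermediate value principle. The parameter b lets it serve the chain of the `f i`,
-- where membership begins to hold, and that of the `t i`, where it ceases.
switch : ∀ b (g : Fin (suc n) → Bool) → g zero ≡ b → g (fromℕ n) ≡ not b →
         ∃ λ j → g (inject₁ j) ≡ b × g (suc j) ≡ not b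
switch {zero}  true  g p q = contradiction (trans (sym p) q) λ ()
switch {zero}  false g p q = contradiction (trans (sym p) q) λ ()
switch {suc n} b g p q with g 1F Bool.≟ b
... | no g₁≢b = zero , p , ¬-not g₁≢b
... | yes g₁≡b with switch b (g ∘ suc) g₁≡b q
...   | j , r , r′ = suc j , r , r′

module Separation (em : ∀ {a} → ExcludedMiddle a)
  (zorn : ∀ {a ℓ₁ ℓ₂ c} → ZornsLemma a ℓ₁ ℓ₂ c)
  {ℓ : Level} {n : ℕ} (A : Algebra (sig n) ℓ) (sat : Satisfies (𝐉 n) A) where

  open DistributiveLattice (truthLattice A sat) using () renaming
    (_≤_ to _⊑_; refl to ⊑-refl; trans to ⊑-trans; antisym to ⊑-antisym;
     x∧y≤x to ⊓-lower₁; x≤x∨y to ⊔-upper₁; ∧-greatest to ⊓-glb; ∨-least to ⊔-lub)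
  open Setoid (domain A) using (_≈_)

  Separated : Carrier A → Carrier A → Set ℓ
  Separated x y = ∃ λ s → Σ[ h ∈ Hom A (𝐈 s) ] ¬ (to h x ≡ to h y)

  -- A prime filter containing x and omitting y contains the greatest constant `t zero` and omits
  -- the least, `f zero`. Membership of ⊤ and ⊥ then decides which prime pair it respects.
  separate-⊑ : ∀ {x y} → ¬ (x ⊑ y) → Separated x y
  separate-⊑ {x} {y} x⋢y = cases (member [⊤]) (member [⊥]) refl refl
    where
    U = PrimeFilterTheorem.primeFilter em zorn (truthLattice A sat) (x ⊑_) (_⊑ y)
      (x , ⊑-refl) ⊓-glb (λ p q → ⊑-trans q p) ⊔-lub ⊑-trans
      (λ x⊑z z⊑y → x⋢y (⊑-trans x⊑z z⊑y))
    open PrimeFilters.PrimeFilter (proj₁ U)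

    [_]ᶜ : J ℓ n → Carrier A
    [ a ]ᶜ = constant A a
    [⊤] = [ ⊤ ]ᶜ
    [⊥] = [ ⊥ ]ᶜ

    x∈ : member x ≡ true
    x∈ = proj₁ (proj₂ U) ⊑-refl

    y∉ : member y ≡ false
    y∉ = proj₂ (proj₂ U) ⊑-refl

    via : ∀ s (𝔖 : Separator ℓ n (size s) (index s)) →
      member [ Separator.c 𝔖 ]ᶜ ≡ true → member [ Separator.d 𝔖 ]ᶜ ≡ false → Separated x y
    via s 𝔖 c∈ d∉ = s , filterHom c∈ d∉ , λ eq → contradiction
      (trans (sym x∈) (trans (member-filterHom c∈ d∉ x)
        (trans (cong (Separator.χ 𝔖) eq) (trans (sym (member-filterHom c∈ d∉ y)) y∉)))) λ ()
      where open Classical.FilterHom em 𝔖 A sat (proj₁ U)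

    t₀∈ : member [ t zero ]ᶜ ≡ true
    t₀∈ = upward {x} {[ t zero ]ᶜ} (satisfies-≤ A sat (var 0F) (name {ℓ} (t zero)) (λ ρ → below (ρ 0F)) (λ (_ : Fin 1) → x)) x∈
      where
      below : (a : J ℓ n) → a ≤ₜ t zero
      below ⊤     = ⊤≤t
      below ⊥     = ⊥≤t
      below (f i) = f≤t
      below (t i) = t≤t z≤n

    f₀∉ : member [ f zero ]ᶜ ≡ false
    f₀∉ = downward {[ f zero ]ᶜ} {y} (satisfies-≤ A sat (name {ℓ} (f zero)) (var 0F) (λ ρ → above (ρ 0F)) (λ (_ : Fin 1) → y)) y∉
      where
      above : (a : J ℓ n) → f zero ≤ₜ a
      above ⊤     = f≤⊤
      above ⊥     = f≤⊥
      above (f i) = f≤f z≤n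
      above (t i) = f≤t

    tₙ∉ : member [⊤] ≡ false → member [⊥] ≡ false → member [ t (fromℕ n) ]ᶜ ≡ false
    tₙ∉ ⊤∉ ⊥∉ = downward {[ t (fromℕ n) ]ᶜ} {joinᴬ A [⊤] [⊥]}
      (satisfies-≤ A sat (name {ℓ} (t (fromℕ n))) (name {ℓ} ⊤ ∨ᵗ name {ℓ} ⊥) (λ ρ → ≤ₜ-refl) (λ (_ : Fin 0) → x))
      (prime ⊤∉ ⊥∉)

    fₙ∈ : member [⊤] ≡ true → member [⊥] ≡ true → member [ f (fromℕ n) ]ᶜ ≡ true
    fₙ∈ ⊤∈ ⊥∈ = upward {meetᴬ A [⊤] [⊥]} {[ f (fromℕ n) ]ᶜ}
      (satisfies-≤ A sat (name {ℓ} ⊤ ∧ᵗ name {ℓ} ⊥) (name {ℓ} (f (fromℕ n))) (λ ρ → ≤ₜ-refl) (λ (_ : Fin 0) → x))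
      (meet ⊤∈ ⊥∈)

    cases : ∀ p q → member [⊤] ≡ p → member [⊥] ≡ q → Separated x y
    cases true  false ⊤∈ ⊥∉ = via zero (separator-⊤⊥ _) ⊤∈ ⊥∉
    cases false true  ⊤∉ ⊥∈ = via zero (separator-⊥⊤ _) ⊥∈ ⊤∉
    -- Now `⊤ ∧ ⊥`, the last of the `f i`, is in the filter, so membership changes somewhere along
    -- that chain; dually for the `t i` in the last case.
    cases true  true  ⊤∈ ⊥∈ =
      let j , d∉ , c∈ = switch false (λ i → member [ f i ]ᶜ) f₀∉ (fₙ∈ ⊤∈ ⊥∈)
      in via (suc j) (separator-f j) c∈ d∉
    cases false false ⊤∉ ⊥∉ =
      let j , c∈ , d∉ = switch true (λ i → member [ t i ]ᶜ) t₀∈ (tₙ∉ ⊤∉ ⊥∉)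
      in via (suc j) (separator-t j) c∈ d∉

  separate : ∀ {x y} → ¬ (x ≈ y) → Separated x y
  separate {x} {y} x≉y with em {P = x ⊑ y} | em {P = y ⊑ x}
  ... | no x⋢y  | _       = separate-⊑ x⋢y
  ... | yes _   | no y⋢x  = let s , h , hy≢hx = separate-⊑ y⋢x in s , h , hy≢hx ∘ sym
  ... | yes x⊑y | yes y⊑x = contradiction (⊑-antisym x⊑y y⊑x) x≉y

-- Varieties, products and quotients

private
  fullSubuniverse : (A : Algebra 𝓢 ℓ) → Subuniverse A
  fullSubuniverse A = record { _∈U = λ _ → Unit ; resp = λ _ _ → tt ; closed = λ _ _ _ → tt }

-- Every algebra placed in the variety below is an image of a power of J, so the subalgebra step can
-- be the full one.
HSP-powerImage : {J B : Algebra 𝓢 ℓ} (I : Set ℓ) (h : Hom (Π I (const J)) B) →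
                 IsSurjective h → HSP J B
HSP-powerImage {J = J} I h h-surj =
  power , (power , (I , const J , (λ _ → refl) , identityHom , id , λ y → y , id) ,
    fullSubuniverse power , intoFull , id , λ y → proj₁ y , id) , h , h-surj
  where
  power : Algebra _ _
  power = Π I (const J)

  identityHom : Hom power power
  identityHom = record
    { func = record { to = id ; cong = id }
    ; preserves = λ o xs → Setoid.refl (domain power)
    }

  intoFull : Hom power (subalgebra power (fullSubuniverse power))
  intoFull = record
    { func = record { to = λ x → x , tt ; cong = id }
    ; preserves = λ o xs → Setoid.refl (domain power)
    }

HSP-image : {J B : Algebra 𝓢 ℓ} (h : Hom J B) → IsSurjective h → HSP J B
HSP-image {J = J} h h-surj = HSP-powerImage Unit (h ∘ʰ projection (const J) tt)
  λ y → (λ _ → proj₁ (h-surj y)) , λ z≈ → proj₂ (h-surj y) (z≈ tt)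

HSP-product : {J : Algebra 𝓢 ℓ} {I : Set ℓ} (ℬ : I → Algebra 𝓢 ℓ) (h : ∀ i → Hom J (ℬ i)) →
              (∀ i → IsSurjective (h i)) → HSP J (Π I ℬ)
HSP-product {J = J} {I} ℬ h h-surj =
  HSP-powerImage I (tuple ℬ λ i → h i ∘ʰ projection (const J) i)
    λ y → (λ i → proj₁ (h-surj i (y i))) , λ z≈ i → proj₂ (h-surj i (y i)) (z≈ i)

quotient : (A : Algebra 𝓢 ℓ) → Congruence A → Algebra 𝓢 ℓ
quotient A θ = record
  { domain  = record { isEquivalence = Congruence.isEquivalence θ }
  ; op      = op A
  ; op-cong = Congruence.compatible θ
  }

quotientHom : (A : Algebra 𝓢 ℓ) (θ : Congruence A) → Hom A (quotient A θ)
quotientHom A θ = record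
  { func = record { to = id ; cong = Congruence.contains-≈ θ }
  ; preserves = λ o xs → Setoid.refl (domain (quotient A θ))
  }

-- Cardinalities and pairwise non-isomorphism.

Fin4↔J₀ : Inverse (setoid (Fin 4)) (setoid (J ℓ 0))
Fin4↔J₀ = mk↔ₛ′
  (λ { 0F → ⊤ ; 1F → ⊥ ; 2F → f 0F ; 3F → t 0F })
  (λ { ⊤ → 0F ; ⊥ → 1F ; (f 0F) → 2F ; (t 0F) → 3F })
  (λ { ⊤ → refl ; ⊥ → refl ; (f 0F) → refl ; (t 0F) → refl })
  (λ { 0F → refl ; 1F → refl ; 2F → refl ; 3F → refl })

Fin6↔J₁ : Inverse (setoid (Fin 6)) (setoid (J ℓ 1))
Fin6↔J₁ = mk↔ₛ′
  (λ { 0F → ⊤ ; 1F → ⊥ ; 2F → f 0F ; 3F → f 1F ; 4F → t 0F ; 5F → t 1F })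
  (λ { ⊤ → 0F ; ⊥ → 1F ; (f 0F) → 2F ; (f 1F) → 3F ; (t 0F) → 4F ; (t 1F) → 5F })
  (λ { ⊤ → refl ; ⊥ → refl ; (f 0F) → refl ; (f 1F) → refl ; (t 0F) → refl ; (t 1F) → refl })
  (λ { 0F → refl ; 1F → refl ; 2F → refl ; 3F → refl ; 4F → refl ; 5F → refl })

-- Homomorphisms fix the named constants, so constants that coincide in the source coincide in the
-- target.
hom-index : {σ : Fin (suc n) → Fin (suc p)} {τ : Fin (suc n) → Fin (suc q)} →
  Hom (reindexed {ℓ} n p σ) (reindexed n q τ) → ∀ {i j} → σ i ≡ σ j → τ i ≡ τ j
hom-index h {i} {j} σi≡σj = t-injective
  (trans (sym (preserves h (tˢ i) (λ ()))) (trans (cong (to h ∘ t) σi≡σj) (preserves h (tˢ j) (λ ()))))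
  where
  t-injective : ∀ {i j} → t i ≡ t j → i ≡ j
  t-injective refl = refl

threshold-fromℕ : ∀ {k n} → k ≤ n → threshold k (fromℕ n) ≡ 1F
threshold-fromℕ {k} {n} k≤n = threshold-≥ {i = fromℕ n} (subst (k ≤_) (sym (Fin.toℕ-fromℕ n)) k≤n)

𝐉₀≇𝐉₁ : 1 ≤ k → k ≤ n → ¬ (𝐉₀ {ℓ} n ≅ 𝐉₁ n k)
𝐉₀≇𝐉₁ {n = n} (s≤s _) k≤n (h , _) = contradiction
  (trans (hom-index h {zero} {fromℕ n} refl) (threshold-fromℕ k≤n)) λ ()

-- If k < k′, the constants of indices k and n coincide only in the source; if k′ < k, those of
-- indices 0 and k′ do.
𝐉₁-injective : 1 ≤ k → k ≤ n → 1 ≤ k′ → k′ ≤ n → 𝐉₁ {ℓ} n k ≅ 𝐉₁ n k′ → k ≡ k′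
𝐉₁-injective {k} {n} {k′} 1≤k k≤n 1≤k′ k′≤n (h , _) with ℕ.<-cmp k k′
... | tri≈ _ k≡k′ _ = k≡k′
... | tri< k<k′ _ _ = contradiction
  (trans (sym (threshold-< {i = i} (subst (_< k′) (sym i≡k) k<k′)))
    (trans (hom-index h (trans (threshold-≥ {i = i} (ℕ.≤-reflexive (sym i≡k))) (sym (threshold-fromℕ k≤n))))
      (threshold-fromℕ k′≤n))) λ ()
  where
  i = fromℕ< (s≤s k≤n)
  i≡k = Fin.toℕ-fromℕ< (s≤s k≤n)
... | tri> _ _ k′<k = contradiction
  (trans (sym (threshold-< {i = zero {n}} 1≤k′))
    (trans (hom-index h (trans (threshold-< {i = zero {n}} 1≤k) (sym (threshold-< {i = i} (subst (_< k) (sym i≡k′) k′<k)))))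
      (threshold-≥ {i = i} (ℕ.≤-reflexive (sym i≡k′))))) λ ()
  where
  i = fromℕ< (s≤s k′≤n)
  i≡k′ = Fin.toℕ-fromℕ< (s≤s k′≤n)

-- Consequences of separation and extension

module Variety (em : ∀ {a} → ExcludedMiddle a)
  (zorn : ∀ {a ℓ₁ ℓ₂ c} → ZornsLemma a ℓ₁ ℓ₂ c) (ℓ : Level) (n : ℕ) where

  module 𝔖 (s : Fin (suc n)) = Separator (separator {n = n} {ℓ = ℓ} s)

  in-𝓥 : ∀ {p σ} → Separator ℓ n p σ → 𝓥 n (reindexed n p σ)
  in-𝓥 𝔖 = HSP-image π π-surjective
    where open Separator 𝔖

  product-in-𝓥 : {I : Set ℓ} (s : I → Fin (suc n)) → 𝓥 n (Π I (𝐈 ∘ s))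
  product-in-𝓥 s = HSP-product (𝐈 ∘ s) (𝔖.π ∘ s) (𝔖.π-surjective ∘ s)

  extendHom : (A B : Algebra (sig n) ℓ) → Satisfies (𝐉 n) A → Satisfies (𝐉 n) B →
    (e : A ↪ B) → ∀ s (h : Hom A (𝐈 s)) → Σ[ g ∈ Hom B (𝐈 s) ] (∀ a → to g (to (proj₁ e) a) ≡ to h a)
  extendHom A B satA satB e s h = Classical.extend em (separator s) zorn A B satA satB e h

  jointlyInjective : (A : Algebra (sig n) ℓ) → Satisfies (𝐉 n) A → ∀ {x y} →
    (∀ s (h : Hom A (𝐈 s)) → to h x ≡ to h y) → Algebra._≈_ A x y
  jointlyInjective A sat same = decidable-stable em λ x≉y →
    let s , h , hx≢hy = Separation.separate em zorn A sat x≉y in hx≢hy (same s h)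

  homs : Algebra (sig n) ℓ → Set ℓ
  homs A = Σ[ s ∈ Fin (suc n) ] Hom A (𝐈 s)

  canonical : (A : Algebra (sig n) ℓ) → Hom A (Π (homs A) (𝐈 ∘ proj₁))
  canonical A = tuple (𝐈 ∘ proj₁) proj₂

  canonical-embedding : (A : Algebra (sig n) ℓ) → Satisfies (𝐉 n) A → IsEmbedding (canonical A)
  canonical-embedding A sat eq = jointlyInjective A sat λ s h → eq (s , h)

  -- Every element of 𝐈 s is the value of a constant.
  hom-surjective : (A : Algebra (sig n) ℓ) → ∀ s (h : Hom A (𝐈 s)) → IsSurjective h
  hom-surjective A s h y = constant A x , λ z≈ → trans (Hom.cong h z≈)
    (trans (hom-eval h _ (name x)) (trans (𝔖.eval-name-M s _ x) (proj₂ (𝔖.section s y))))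
    where x = proj₁ (𝔖.section s y)

  -- The canonical map into the product over all homomorphisms to the `𝐈 s` is a subdirect
  -- embedding, so irreducibility makes one of these homomorphisms an isomorphism.
  classify : (A : Algebra (sig n) ℓ) → 𝓥 n A → SubdirectlyIrreducible A → ∃ λ s → A ≅ 𝐈 s
  classify A A∈𝓥 (_ , irreducible) =
    let (s , h) , h-inj , h-surj = irreducible (homs A) (𝐈 ∘ proj₁) (canonical A)
          (canonical-embedding A (HSP-satisfies A∈𝓥)) (λ (s , h) → hom-surjective A s h)
    in s , h , h-inj , h-surj

  product-injective : {I : Set ℓ} (s : I → Fin (suc n)) → InjectiveIn (𝓥 n) (Π I (𝐈 ∘ s))
  product-injective s = product-in-𝓥 s , λ A B A∈𝓥 B∈𝓥 e h →
    let ext = λ i → extendHom A B (HSP-satisfies A∈𝓥) (HSP-satisfies B∈𝓥) e (s i)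
                      (projection (𝐈 ∘ s) i ∘ʰ h)
    in tuple (𝐈 ∘ s) (proj₁ ∘ ext) , λ a i → proj₂ (ext i) a

  injective : ∀ s → InjectiveIn (𝓥 n) (𝐈 s)
  injective s = in-𝓥 (separator s) , λ A B A∈𝓥 B∈𝓥 e h →
    extendHom A B (HSP-satisfies A∈𝓥) (HSP-satisfies B∈𝓥) e s h

  enoughInjectives : EnoughInjectives {ℓ = ℓ} (𝓥 n)
  enoughInjectives A A∈𝓥 = Π (homs A) (𝐈 ∘ proj₁) , product-injective proj₁ ,
    canonical A , canonical-embedding A (HSP-satisfies A∈𝓥)

  -- Θ is the intersection of the kernels of those homomorphisms from B to some `𝐈 s` that identify
  -- all θ-related pairs.
  congruenceExtension : CongruenceExtensionProperty {ℓ = ℓ} (𝓥 n)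
  congruenceExtension B B∈𝓥 U θ = Θ , λ x y → (λ xθy s g θ⊆g → θ⊆g x y xθy) , restrict x y
    where
    D = subalgebra B U
    satB = HSP-satisfies B∈𝓥

    satD : Satisfies (𝐉 n) D
    satD = satisfies-subdirect {I = Unit {ℓ}} (const B) (const (inclusion U)) (λ eq → eq tt) (const satB)

    Q = quotient D θ

    satQ : Satisfies (𝐉 n) Q
    satQ = satisfies-image (quotientHom D θ) (λ y → y , Congruence.contains-≈ θ) satD

    Θ : Congruence B
    Θ = record
      { _θ_ = λ x y → ∀ s (g : Hom B (𝐈 s)) →
          (∀ u v → Congruence._θ_ θ u v → to g (proj₁ u) ≡ to g (proj₁ v)) → to g x ≡ to g y
      ; contains-≈ = λ x≈y s g _ → Hom.cong g x≈y
      ; isEquivalence = record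
        { refl  = λ s g _ → refl
        ; sym   = λ p s g θ⊆g → sym (p s g θ⊆g)
        ; trans = λ p q s g θ⊆g → trans (p s g θ⊆g) (q s g θ⊆g)
        }
      ; compatible = λ o p s g θ⊆g → trans (preserves g o _)
          (trans (op-cong (𝐈 s) o λ i → p i s g θ⊆g) (sym (preserves g o _)))
      }

    restrict : ∀ x y → Congruence._θ_ Θ (proj₁ x) (proj₁ y) → Congruence._θ_ θ x y
    restrict x y xΘy = jointlyInjective Q satQ λ s h →
      -- A homomorphism on the quotient by θ, seen on D and extended to B, is among those defining
      -- Θ; such homomorphisms separate the quotient.
      let g , g≡h = extendHom D B satD satB (inclusion U , id) s (h ∘ʰ quotientHom D θ)
      in trans (sym (g≡h x))
           (trans (xΘy s g λ u v uθv → trans (g≡h u) (trans (Hom.cong h uθv) (sym (g≡h v)))) (g≡h y))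

  -- The amalgam is the product over all pairs of homomorphisms from B and C to a common `𝐈 s` that
  -- agree on A. Each homomorphism on one side occurs in such a pair, since its restriction to A
  -- extends to the other side; hence both maps are embeddings.
  amalgamation : AmalgamationProperty {ℓ = ℓ} (𝓥 n)
  amalgamation A B C A∈𝓥 B∈𝓥 C∈𝓥 (e , e-inj) (e′ , e′-inj) =
    Π I (𝐈 ∘ proj₁) , product-in-𝓥 proj₁ ,
    (tuple (𝐈 ∘ proj₁) (λ (_ , g , _) → g) , λ eq → jointlyInjective B satB λ s g →
      let g′ , g′≡g = extendHom A C satA satC (e′ , e′-inj) s (g ∘ʰ e)
      in eq (s , g , g′ , sym ∘ g′≡g)) ,
    (tuple (𝐈 ∘ proj₁) (λ (_ , _ , g′ , _) → g′) , λ eq → jointlyInjective C satC λ s g′ →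
      let g , g≡g′ = extendHom A B satA satB (e , e-inj) s (g′ ∘ʰ e′)
      in eq (s , g , g′ , g≡g′)) ,
    λ a (_ , _ , _ , agree) → agree a
    where
    satA = HSP-satisfies A∈𝓥
    satB = HSP-satisfies B∈𝓥
    satC = HSP-satisfies C∈𝓥

    I : Set ℓ
    I = Σ[ s ∈ Fin (suc n) ] Σ[ g ∈ Hom B (𝐈 s) ] Σ[ g′ ∈ Hom C (𝐈 s) ]
          (∀ a → to g (to e a) ≡ to g′ (to e′ a))

level : 1 ≤ k → k ≤ n → ∃ λ (j : Fin n) → suc (toℕ j) ≡ k
level (s≤s _) k≤n = fromℕ< k≤n , cong suc (Fin.toℕ-fromℕ< k≤n)

-- The index maps `const zero` and `id` on `Fin 1` agree pointwise but not definitionally, hence the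
-- transport.
𝐉₀≅𝐉-zero : {A : Algebra (sig 0) ℓ} → A ≅ 𝐉₀ 0 → A ≅ 𝐉 0
𝐉₀≅𝐉-zero (h , h-inj , h-surj) = rename ∘ʰ h ,
  (λ {x} {y} eq → h-inj (trans (sym (mapJ-id (to h x))) (trans eq (mapJ-id (to h y))))) ,
  λ y → proj₁ (h-surj y) , λ z≈ → trans (mapJ-id _) (proj₂ (h-surj y) z≈)
  where
  rename : Hom (𝐉₀ 0) (𝐉 0)
  rename = mapHom id id refl (Fin1-unique zero)

  mapJ-id : ∀ {p} (x : J ℓ p) → mapJ id x ≡ x
  mapJ-id ⊤     = refl
  mapJ-id ⊥     = refl
  mapJ-id (f i) = refl
  mapJ-id (t i) = refl

proposition2p6 : (∀ {a} → ExcludedMiddle a) →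
    (∀ {a ℓ₁ ℓ₂ c} → ZornsLemma a ℓ₁ ℓ₂ c) →
    (ℓ : Level) →
    ( 𝓥 {ℓ} 0 (𝐉 0) × SubdirectlyIrreducible {ℓ = ℓ} (𝐉 0)
    × (∀ A → 𝓥 {ℓ} 0 A → SubdirectlyIrreducible A → A ≅ 𝐉 0))
    ×
    (∀ n → 1 ≤ n →
    ( 𝓥 {ℓ} n (𝐉₀ n) × SubdirectlyIrreducible {ℓ = ℓ} (𝐉₀ n)
    × Inverse (setoid (Fin 4)) (Algebra.domain (𝐉₀ {ℓ} n)))
    ×
    (∀ k → 1 ≤ k → k ≤ n →
    𝓥 {ℓ} n (𝐉₁ n k) × SubdirectlyIrreducible {ℓ = ℓ} (𝐉₁ n k)
    × Inverse (setoid (Fin 6)) (Algebra.domain (𝐉₁ {ℓ} n k)))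
    ×
    (∀ k → 1 ≤ k → k ≤ n → ¬ (𝐉₀ {ℓ} n ≅ 𝐉₁ n k))
    ×
    (∀ k k′ → 1 ≤ k → k ≤ n → 1 ≤ k′ → k′ ≤ n → 𝐉₁ {ℓ} n k ≅ 𝐉₁ n k′ → k ≡ k′)
    ×
    (∀ A → 𝓥 {ℓ} n A → SubdirectlyIrreducible A →
    A ≅ 𝐉₀ n ⊎ (∃ λ k → 1 ≤ k × k ≤ n × A ≅ 𝐉₁ n k)))
    ×
    (∀ n →
    ( InjectiveIn (𝓥 {ℓ} n) (𝐉₀ n)
    × (∀ k → 1 ≤ k → k ≤ n → InjectiveIn (𝓥 {ℓ} n) (𝐉₁ n k)))
    ×
    EnoughInjectives (𝓥 {ℓ} n)
    ×
    CongruenceExtensionProperty (𝓥 {ℓ} n) × AmalgamationProperty (𝓥 {ℓ} n))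
proposition2p6 em zorn ℓ =
  ( in-𝓥 0 four , Classical.subdirectlyIrreducible em four
  , λ A A∈𝓥 si → case classify 0 A A∈𝓥 si of λ { (zero , A≅𝐈) → 𝐉₀≅𝐉-zero A≅𝐈 } ) ,
  (λ n 1≤n →
    ( in-𝓥 n (separator zero) , Classical.subdirectlyIrreducible em (separator zero) , Fin4↔J₀ ) ,
    (λ k 1≤k k≤n → case level 1≤k k≤n of λ
      { (j , refl) → in-𝓥 n (separator (suc j)) , Classical.subdirectlyIrreducible em (separator (suc j)) , Fin6↔J₁ }) ,
    (λ k → 𝐉₀≇𝐉₁) ,
    (λ k k′ → 𝐉₁-injective) ,
    λ A A∈𝓥 si → case classify n A A∈𝓥 si of λ where
      (zero  , A≅𝐈) → inj₁ A≅𝐈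
      (suc j , A≅𝐈) → inj₂ (suc (toℕ j) , s≤s z≤n , Fin.toℕ<n j , A≅𝐈)) ,
  λ n →
    ( injective n zero
    , λ k 1≤k k≤n → case level 1≤k k≤n of λ { (j , refl) → injective n (suc j) } ) ,
    enoughInjectives n , congruenceExtension n , amalgamation n
  where
  open Variety em zorn ℓ
  -- With `id` as index map the separated algebra is definitionally `𝐉 0`.
  four : Separator ℓ 0 0 id
  four = separator-⊤⊥ id
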